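{- Let $p$ be a prime number and let $d,\varrho$ be integers such that either (a) $3\le \varrho\le p$ and $\varrho\le d\le p+1$, or (b) $\varrho=2$ and $d\ge 2$. Put $m=d-\varrho+1$. Then, as $k\to\infty$ (with $p,d,\varrho$ fixed), $$\ln N(p^k,d,\varrho)\ \ge\ (1+o(1))\,(k+m)\,p^{(k-2)m-1}\ln p .$$
   Context: For an integer $q\ge 2$ let $Q=\{0,1,\dots,q-1\}$. For $0\le t\le d$, a $t$-dimensional axis-aligned plane in $Q^d$ is a set obtained by fixing the values of $d-t$ of the coordinates and letting the remaining $t$ coordinates range freely over $Q$. A subset $C\subseteq Q^d$ is an MDS code of order $q$, length $d$ and code distance $\varrho=t+1$ if $|C\cap\Gamma|=1$ for every $t$-dimensional axis-aligned plane $\Gamma$ in $Q^d$. $N(q,d,\varrho)$ denotes the number of MDS codes in $Q^d$ of order $q$, length $d$ and code distance $\varrho$. -}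

module Defs where

open import Data.Nat using (ℕ; zero; suc; _+_; _∸_)
open import Data.Bool using (Bool; true; false; _∧_; _∨_; if_then_else_)
open import Data.List using (List; []; _∷_; map; concatMap; _++_; allFin)
open import Data.Fin using (Fin)
open import Data.Fin.Properties using () renaming (_≟_ to _≟ᶠ_)
open import Data.Vec using (Vec; []; _∷_)
open import Relation.Nullary.Decidable using (⌊_⌋)

allVecs : {A : Set} → List A → (d : ℕ) → List (Vec A d)
allVecs xs zero    = [] ∷ []
allVecs xs (suc d) = concatMap (λ a → map (a ∷_) (allVecs xs d)) xs

Point : ℕ → ℕ → Set
Point q d = Vec (Fin q) d

allPoints : (q d : ℕ) → List (Point q d)
allPoints q d = allVecs (allFin q) d

-- all sublists (= all subsets of a duplicate-free list)
sublists : {A : Set} → List A → List (List A)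
sublists []       = [] ∷ []
sublists (x ∷ xs) = let r = sublists xs in map (x ∷_) r ++ r

allB : {A : Set} → (A → Bool) → List A → Bool
allB f []       = true
allB f (x ∷ xs) = f x ∧ allB f xs

count : {A : Set} → (A → Bool) → List A → ℕ
count f []       = 0
count f (x ∷ xs) = if f x then suc (count f xs) else count f xs

-- number of free coordinates of a choice S of free coordinates
numTrue : {d : ℕ} → Vec Bool d → ℕ
numTrue []            = 0
numTrue (true ∷ s)    = suc (numTrue s)
numTrue (false ∷ s)   = numTrue s

_==ᶠ_ : {q : ℕ} → Fin q → Fin q → Bool
a ==ᶠ b = ⌊ a ≟ᶠ b ⌋

inPlane : {q d : ℕ} → Vec Bool d → Point q d → Point q d → Bool
inPlane []      []      []      = true
inPlane (s ∷ S) (a ∷ x) (b ∷ y) = (s ∨ (a ==ᶠ b)) ∧ inPlane S x y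

_==ᴺ_ : ℕ → ℕ → Bool
zero  ==ᴺ zero  = true
suc m ==ᴺ suc n = m ==ᴺ n
_     ==ᴺ _     = false

-- C (a list of points, a subset of Q^d) is an MDS code of code distance ρ:
-- every t-dimensional axis-aligned plane (t = ρ - 1), given by a set S of
-- t free coordinates and a point x fixing the others, meets C in exactly one point.
isMDS : (q d ρ : ℕ) → List (Point q d) → Bool
isMDS q d ρ C =
  allB (λ S → if numTrue S ==ᴺ (ρ ∸ 1)
               then allB (λ x → count (inPlane S x) C ==ᴺ 1) (allPoints q d)
               else true)
      (allVecs (true ∷ false ∷ []) d)

N : ℕ → ℕ → ℕ → ℕ
N q d ρ = count (isMDS q d ρ) (sublists (allPoints q d))

{-# OPTIONS --safe #-}

-- Put t = ρ − 1, d = t + m and F = Fin p. A word over Fin (p ^ k) is read as k layers in F^d. The words all of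
-- whose layers have zero syndrome for the parity check matrix of an (extended) Reed–Solomon code form an MDS
-- code, and they are determined by the message f consisting of their last m symbols. We perturb this code by
-- asking for the syndrome s(f) ⊗ (1, …, 1) instead of 0. The result is still MDS when
-- s (f + a ⊗ s(f)) = s(f) for all a in F^m, and it determines s.
-- Such an s arises from any family of disjoint cubes g + F^m ⊗ u in the message space: let s be u on the cube
-- g + F^m ⊗ u and 0 elsewhere. There are p^((k−1)(m+1)) cubes whose direction u has first digit 1, and
-- each of them meets at most p^(m+k−1) of them; so T = p^((k−2)m−1) disjoint ones can be chosen greedily, with
-- p^(k+m) − p^(m+k−1) ≥ p^(k+m−1) possibilities for each choice, hence N ≥ p^((k+m−1) T).
module Submission where

open import Defs
open import Algebra.Bundles using (CommutativeRing)
open import Algebra.Core using (Op₁; Op₂)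
open import Algebra.Structures using (IsCommutativeRing)
import Algebra.Properties.Group
import Algebra.Properties.Ring
import Algebra.Solver.Ring.NaturalCoefficients.Default
open import Data.Bool using (Bool; true; false; if_then_else_; T?)
open import Data.Bool.Properties using (T-≡)
open import Data.Fin using (Fin; zero; suc; toℕ; inject≤; finToFun; funToFin; combine)
open import Data.Fin.Properties using (_≟_; all?; toℕ-fromℕ<; toℕ-injective; toℕ<n; inject≤-injective; finToFun-funToFin; funToFin-finToFin)
open import Data.List using (List; []; _∷_; _++_; length; map; filter; concatMap; allFin; cartesianProductWith)
open import Data.List.Properties using (length-++; length-map; length-tabulate)
import Data.List.Membership.DecPropositional as DecMembership
open import Data.List.Membership.Propositional using (_∈_; _∉_)
open import Data.List.Membership.Propositional.Properties
open import Data.List.Relation.Binary.Subset.Propositional using (_⊆_)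
open import Data.List.Relation.Unary.All as All using (All; []; _∷_)
open import Data.List.Relation.Unary.AllPairs as AllPairs using (AllPairs; []; _∷_)
open import Data.List.Relation.Unary.Any using (here; there)
open import Data.List.Relation.Unary.Unique.Propositional using (Unique)
import Data.List.Relation.Unary.Unique.Propositional.Properties as Unique
open import Data.Nat as ℕ using (ℕ; zero; suc; NonZero; _+_; _*_; _∸_; _^_; _%_; _≡ᵇ_; _≤_; _<_; z≤n; s≤s; z<s; s<s)
import Data.Nat.Properties as ℕ
open import Data.Nat.Coprimality using (coprime-Bézout; prime⇒coprime)
open import Data.Nat.DivMod using (_mod_; m%n%n≡m%n; %-distribˡ-+; %-distribˡ-*; m<n⇒m%n≡m; n%n≡0; m%n<n; [m+kn]%n≡m%n)
import Data.Nat.GCD as GCD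
open import Data.Nat.Primality using (Prime; prime⇒nonZero; prime⇒nonTrivial)
open import Data.Nat.Tactic.RingSolver using (solve-∀)
open import Data.Product using (_×_; _,_; proj₁; proj₂; ∃)
open import Data.Sum using (_⊎_; inj₁; inj₂)
open import Data.Unit using (⊤; tt)
open import Data.Vec as Vec using (Vec; []; _∷_; zipWith; replicate; tabulate; lookup; drop; head; tail) renaming (_++_ to _++ᵛ_)
import Data.Vec.Properties as Vec
open import Data.Vec.Relation.Unary.All as VecAll using ([]; _∷_) renaming (All to VecAll)
import Data.Vec.Relation.Unary.All.Properties as VecAll
open import Data.Vec.Relation.Unary.AllPairs as VecAllPairs using ([]; _∷_) renaming (AllPairs to VecAllPairs)
import Data.Vec.Relation.Unary.AllPairs.Properties as VecAllPairs
open import Function using (_∘_; id; _on_; Equivalence)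
open import Relation.Binary.Definitions using (DecidableEquality)
open import Relation.Binary.PropositionalEquality
open import Relation.Nullary using (Dec; ¬_; yes; no; contradiction)
open import Relation.Nullary.Decidable using (⌊_⌋; ¬?; fromWitness; toWitness)

-- Arithmetic modulo `p`.

module Residues (p : ℕ) .{{_ : NonZero p}} where
  infixl 5 _⊕_
  infixl 6 _⊗_

  _⊕_ _⊗_ : Op₂ (Fin p)
  a ⊕ b = (toℕ a ℕ.+ toℕ b) mod p
  a ⊗ b = (toℕ a ℕ.* toℕ b) mod p

  ⊖_ : Op₁ (Fin p)
  ⊖ a = (p ∸ toℕ a) mod p

  toℕ-mod : ∀ n → toℕ (n mod p) ≡ n % p
  toℕ-mod n = toℕ-fromℕ< (m%n<n n p)

  mod-cong : ∀ {m n} → m % p ≡ n % p → m mod p ≡ n mod p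
  mod-cong {m} {n} eq = toℕ-injective (trans (toℕ-mod m) (trans eq (sym (toℕ-mod n))))

  mod-toℕ : ∀ a → toℕ a mod p ≡ a
  mod-toℕ a = toℕ-injective (trans (toℕ-mod (toℕ a)) (m<n⇒m%n≡m (toℕ<n a)))

  private
    %-mod : ∀ n → toℕ (n mod p) % p ≡ n % p
    %-mod n = trans (cong (_% p) (toℕ-mod n)) (m%n%n≡m%n n p)

  -- With `mod-toℕ`, this and `mod-*` carry the ring laws over from ℕ: operands are written as
  -- `toℕ a mod p` and the reduction is moved outwards.
  mod-+ : ∀ m n → m mod p ⊕ n mod p ≡ (m ℕ.+ n) mod p
  mod-+ m n = mod-cong (begin
    (toℕ (m mod p) ℕ.+ toℕ (n mod p)) % p              ≡⟨ %-distribˡ-+ (toℕ (m mod p)) _ p ⟩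
    (toℕ (m mod p) % p ℕ.+ toℕ (n mod p) % p) % p      ≡⟨ cong₂ (λ u v → (u ℕ.+ v) % p) (%-mod m) (%-mod n) ⟩
    (m % p ℕ.+ n % p) % p                              ≡⟨ %-distribˡ-+ m n p ⟨
    (m ℕ.+ n) % p                                      ∎) where open ≡-Reasoning

  mod-* : ∀ m n → m mod p ⊗ n mod p ≡ (m ℕ.* n) mod p
  mod-* m n = mod-cong (begin
    (toℕ (m mod p) ℕ.* toℕ (n mod p)) % p              ≡⟨ %-distribˡ-* (toℕ (m mod p)) _ p ⟩
    ((toℕ (m mod p) % p) ℕ.* (toℕ (n mod p) % p)) % p  ≡⟨ cong₂ (λ u v → (u ℕ.* v) % p) (%-mod m) (%-mod n) ⟩
    ((m % p) ℕ.* (n % p)) % p                          ≡⟨ %-distribˡ-* m n p ⟨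
    (m ℕ.* n) % p                                      ∎) where open ≡-Reasoning

  ⊕-comm : ∀ a b → a ⊕ b ≡ b ⊕ a
  ⊕-comm a b = cong (_mod p) (ℕ.+-comm (toℕ a) (toℕ b))

  ⊗-comm : ∀ a b → a ⊗ b ≡ b ⊗ a
  ⊗-comm a b = cong (_mod p) (ℕ.*-comm (toℕ a) (toℕ b))

  ⊕-assoc : ∀ a b c → (a ⊕ b) ⊕ c ≡ a ⊕ (b ⊕ c)
  ⊕-assoc a b c = begin
    (a ⊕ b) ⊕ c                       ≡⟨ cong ((a ⊕ b) ⊕_) (mod-toℕ c) ⟨
    (a ⊕ b) ⊕ toℕ c mod p             ≡⟨ mod-+ _ (toℕ c) ⟩
    (toℕ a ℕ.+ toℕ b ℕ.+ toℕ c) mod p ≡⟨ cong (_mod p) (ℕ.+-assoc (toℕ a) _ _) ⟩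
    (toℕ a ℕ.+ (toℕ b ℕ.+ toℕ c)) mod p ≡⟨ mod-+ (toℕ a) _ ⟨
    toℕ a mod p ⊕ (b ⊕ c)             ≡⟨ cong (_⊕ (b ⊕ c)) (mod-toℕ a) ⟩
    a ⊕ (b ⊕ c)                       ∎ where open ≡-Reasoning

  ⊗-assoc : ∀ a b c → (a ⊗ b) ⊗ c ≡ a ⊗ (b ⊗ c)
  ⊗-assoc a b c = begin
    (a ⊗ b) ⊗ c                       ≡⟨ cong ((a ⊗ b) ⊗_) (mod-toℕ c) ⟨
    (a ⊗ b) ⊗ toℕ c mod p             ≡⟨ mod-* _ (toℕ c) ⟩
    (toℕ a ℕ.* toℕ b ℕ.* toℕ c) mod p ≡⟨ cong (_mod p) (ℕ.*-assoc (toℕ a) _ _) ⟩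
    (toℕ a ℕ.* (toℕ b ℕ.* toℕ c)) mod p ≡⟨ mod-* (toℕ a) _ ⟨
    toℕ a mod p ⊗ (b ⊗ c)             ≡⟨ cong (_⊗ (b ⊗ c)) (mod-toℕ a) ⟩
    a ⊗ (b ⊗ c)                       ∎ where open ≡-Reasoning

  ⊕-identityˡ : ∀ a → 0 mod p ⊕ a ≡ a
  ⊕-identityˡ a = begin
    0 mod p ⊕ a           ≡⟨ cong (0 mod p ⊕_) (mod-toℕ a) ⟨
    0 mod p ⊕ toℕ a mod p ≡⟨ mod-+ 0 _ ⟩
    toℕ a mod p           ≡⟨ mod-toℕ a ⟩
    a                     ∎ where open ≡-Reasoning

  ⊗-identityˡ : ∀ a → 1 mod p ⊗ a ≡ a
  ⊗-identityˡ a = begin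
    1 mod p ⊗ a           ≡⟨ cong (1 mod p ⊗_) (mod-toℕ a) ⟨
    1 mod p ⊗ toℕ a mod p ≡⟨ mod-* 1 _ ⟩
    (1 ℕ.* toℕ a) mod p   ≡⟨ cong (_mod p) (ℕ.*-identityˡ (toℕ a)) ⟩
    toℕ a mod p           ≡⟨ mod-toℕ a ⟩
    a                     ∎ where open ≡-Reasoning

  ⊖-inverseˡ : ∀ a → (⊖ a) ⊕ a ≡ 0 mod p
  ⊖-inverseˡ a = begin
    (⊖ a) ⊕ a                     ≡⟨ cong ((⊖ a) ⊕_) (mod-toℕ a) ⟨
    (⊖ a) ⊕ toℕ a mod p           ≡⟨ mod-+ (p ∸ toℕ a) _ ⟩
    (p ∸ toℕ a ℕ.+ toℕ a) mod p   ≡⟨ cong (_mod p) (ℕ.m∸n+n≡m (ℕ.<⇒≤ (toℕ<n a))) ⟩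
    p mod p                       ≡⟨ mod-cong (trans (n%n≡0 p) (sym (m<n⇒m%n≡m (ℕ.>-nonZero⁻¹ p)))) ⟩
    0 mod p                       ∎ where open ≡-Reasoning

  ⊗-distribˡ : ∀ a b c → a ⊗ (b ⊕ c) ≡ a ⊗ b ⊕ a ⊗ c
  ⊗-distribˡ a b c = begin
    a ⊗ (b ⊕ c)                                ≡⟨ cong (_⊗ (b ⊕ c)) (mod-toℕ a) ⟨
    toℕ a mod p ⊗ (b ⊕ c)                      ≡⟨ mod-* (toℕ a) _ ⟩
    (toℕ a ℕ.* (toℕ b ℕ.+ toℕ c)) mod p        ≡⟨ cong (_mod p) (ℕ.*-distribˡ-+ (toℕ a) _ _) ⟩
    (toℕ a ℕ.* toℕ b ℕ.+ toℕ a ℕ.* toℕ c) mod p ≡⟨ mod-+ (toℕ a ℕ.* toℕ b) _ ⟨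
    a ⊗ b ⊕ a ⊗ c                              ∎ where open ≡-Reasoning

  isCommutativeRing : IsCommutativeRing _≡_ _⊕_ _⊗_ ⊖_ (0 mod p) (1 mod p)
  isCommutativeRing = record
    { isRing = record
      { +-isAbelianGroup = record
        { isGroup = record
          { isMonoid = record
            { isSemigroup = record
              { isMagma = record { isEquivalence = isEquivalence ; ∙-cong = cong₂ _⊕_ }
              ; assoc = ⊕-assoc }
            ; identity = ⊕-identityˡ , λ a → trans (⊕-comm a _) (⊕-identityˡ a) }
          ; inverse = ⊖-inverseˡ , (λ a → trans (⊕-comm a _) (⊖-inverseˡ a))
          ; ⁻¹-cong = cong ⊖_ }
        ; comm = ⊕-comm }
      ; *-cong = cong₂ _⊗_
      ; *-assoc = ⊗-assoc
      ; *-identity = ⊗-identityˡ , λ a → trans (⊗-comm a _) (⊗-identityˡ a)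
      ; distrib = ⊗-distribˡ , λ a b c → trans (⊗-comm (b ⊕ c) a)
                    (trans (⊗-distribˡ a b c) (cong₂ _⊕_ (⊗-comm a b) (⊗-comm a c))) }
    ; *-comm = ⊗-comm }

module _ {p : ℕ} (p-prime : Prime p) where
  private instance
    p≢0 : NonZero p
    p≢0 = prime⇒nonZero p-prime
  open Residues p

  -- Bézout's identity for the coprime pair `p` and `toℕ a`, read modulo `p`.
  residue-inverse : ∀ a → a ≢ 0 mod p → ∃ λ b → b ⊗ a ≡ 1 mod p
  residue-inverse a a≢0 = bezout (coprime-Bézout (prime⇒coprime p-prime {{nz}} (toℕ<n a)))
    where
    nz : NonZero (toℕ a)
    nz = ℕ.≢-nonZero λ eq → a≢0 (trans (sym (mod-toℕ a)) (cong (_mod p) eq))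
    bezout : GCD.Bézout.Identity 1 p (toℕ a) → ∃ λ b → b ⊗ a ≡ 1 mod p
    bezout (GCD.Bézout.-+ x y eq) = y mod p , (begin
      y mod p ⊗ a                ≡⟨ cong (y mod p ⊗_) (mod-toℕ a) ⟨
      y mod p ⊗ toℕ a mod p      ≡⟨ mod-* y _ ⟩
      (y ℕ.* toℕ a) mod p        ≡⟨ cong (_mod p) eq ⟨
      (1 ℕ.+ x ℕ.* p) mod p      ≡⟨ mod-cong ([m+kn]%n≡m%n 1 x p) ⟩
      1 mod p                    ∎) where open ≡-Reasoning
    -- Here 1 + y a is a multiple of `p`, so y a is -1 and the inverse is -y.
    bezout (GCD.Bézout.+- x y eq) = ⊖ (y mod p) , (begin
      (⊖ (y mod p)) ⊗ a            ≡⟨ -‿distribˡ-* (y mod p) a ⟨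
      ⊖ (y mod p ⊗ a)              ≡⟨ -[y*a]≡1 ⟩
      1 mod p                      ∎)
      where
      open ≡-Reasoning
      F : CommutativeRing _ _
      F = record { isCommutativeRing = isCommutativeRing }
      open CommutativeRing F using (ring; +-group)
      open import Algebra.Properties.Ring ring using (-‿distribˡ-*)
      open import Algebra.Properties.Group +-group using (inverseˡ-unique)
      -[y*a]≡1 : ⊖ (y mod p ⊗ a) ≡ 1 mod p
      -[y*a]≡1 = sym (inverseˡ-unique _ _ (begin
        1 mod p ⊕ y mod p ⊗ a           ≡⟨ cong (λ e → 1 mod p ⊕ y mod p ⊗ e) (mod-toℕ a) ⟨
        1 mod p ⊕ y mod p ⊗ toℕ a mod p ≡⟨ cong (1 mod p ⊕_) (mod-* y _) ⟩
        1 mod p ⊕ (y ℕ.* toℕ a) mod p   ≡⟨ mod-+ 1 _ ⟩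
        (1 ℕ.+ y ℕ.* toℕ a) mod p       ≡⟨ cong (_mod p) eq ⟩
        (x ℕ.* p) mod p                 ≡⟨ mod-cong ([m+kn]%n≡m%n 0 x p) ⟩
        0 mod p                         ∎))

-- Counting in duplicate-free lists, and enumerations.

private variable
  A B : Set

-- Induction that deletes one occurrence of `f x` from `ys`: by injectivity the images of the other
-- elements survive the deletion.
injection⇒length≤ : {xs : List A} {ys : List B} (f : A → B) → Unique xs →
  (∀ {x} → x ∈ xs → f x ∈ ys) → (∀ {x y} → x ∈ xs → y ∈ xs → f x ≡ f y → x ≡ y) →
  length xs ≤ length ys
injection⇒length≤ {xs = []} f u into inj = z≤n
injection⇒length≤ {xs = x ∷ xs} {ys} f u@(_ ∷ us) into inj with ∈-∃++ (into (here refl))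
... | as , bs , refl = begin
  suc (length xs)          ≤⟨ s≤s (injection⇒length≤ f us into′ λ y z → inj (there y) (there z)) ⟩
  suc (length (as ++ bs))  ≡⟨ cong suc (length-++ as) ⟩
  suc (length as + length bs) ≡⟨ ℕ.+-suc _ _ ⟨
  length as + suc (length bs) ≡⟨ length-++ as ⟨
  length (as ++ f x ∷ bs)  ∎
  where
  open ℕ.≤-Reasoning
  into′ : ∀ {y} → y ∈ xs → f y ∈ as ++ bs
  into′ {y} y∈ with ∈-++⁻ as (into (there y∈))
  ... | inj₁ fy∈as = ∈-++⁺ˡ fy∈as
  ... | inj₂ (there fy∈bs) = ∈-++⁺ʳ as fy∈bs
  ... | inj₂ (here fy≡fx) with refl ← inj (there y∈) (here refl) fy≡fx =
    contradiction y∈ (Unique.Unique[x∷xs]⇒x∉xs u)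

count≡length-filter : (f : A → Bool) (xs : List A) → count f xs ≡ length (filter (T? ∘ f) xs)
count≡length-filter f [] = refl
count≡length-filter f (x ∷ xs) with f x
... | true  = cong suc (count≡length-filter f xs)
... | false = count≡length-filter f xs

injection⇒length≤count : {xs : List A} {ys : List B} (f : A → B) (g : B → Bool) → Unique xs →
  (∀ {x} → x ∈ xs → f x ∈ ys) → (∀ {x} → x ∈ xs → g (f x) ≡ true) →
  (∀ {x y} → x ∈ xs → y ∈ xs → f x ≡ f y → x ≡ y) → length xs ≤ count g ys
injection⇒length≤count {ys = ys} f g u into sat inj rewrite count≡length-filter g ys =
  injection⇒length≤ f u (λ x∈ → ∈-filter⁺ (T? ∘ g) (into x∈) (Equivalence.from T-≡ (sat x∈))) inj

-- Both inequalities come from injections, between the elements that pass the test and the list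
-- `x ∷ []`.
count-unique : {xs : List A} {x : A} (f : A → Bool) → Unique xs → x ∈ xs → f x ≡ true →
  (∀ {y} → y ∈ xs → f y ≡ true → y ≡ x) → count f xs ≡ 1
count-unique {xs = xs} {x} f u x∈ fx only = ℕ.≤-antisym
  (subst (_≤ 1) (sym (count≡length-filter f xs))
    (injection⇒length≤ {ys = x ∷ []} id (Unique.filter⁺ (T? ∘ f) u)
      (λ y∈ → let y∈xs , fy = ∈-filter⁻ (T? ∘ f) y∈ in here (only y∈xs (Equivalence.to T-≡ fy)))
      (λ _ _ eq → eq)))
  (injection⇒length≤count {xs = x ∷ []} id f ([] ∷ []) (λ { (here refl) → x∈ }) (λ { (here refl) → fx })
    (λ _ _ eq → eq))

-- This makes a code cut out by a Boolean test one of the candidates over which `N` counts.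
filter∈sublists : (f : A → Bool) (xs : List A) → filter (T? ∘ f) xs ∈ sublists xs
filter∈sublists f [] = here refl
filter∈sublists f (x ∷ xs) with f x
... | true  = ∈-++⁺ˡ (∈-map⁺ (x ∷_) (filter∈sublists f xs))
... | false = ∈-++⁺ʳ (map (x ∷_) (sublists xs)) (filter∈sublists f xs)

allB⁺ : (f : A → Bool) (xs : List A) → (∀ x → f x ≡ true) → allB f xs ≡ true
allB⁺ f [] h = refl
allB⁺ f (x ∷ xs) h rewrite h x = allB⁺ f xs h

length-cartesianProductWith : {C : Set} (f : A → B → C) (xs : List A) (ys : List B) →
  length (cartesianProductWith f xs ys) ≡ length xs * length ys
length-cartesianProductWith f [] ys = refl
length-cartesianProductWith f (x ∷ xs) ys = trans (length-++ (map (f x) ys))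
  (cong₂ _+_ (length-map (f x) ys) (length-cartesianProductWith f xs ys))

allVecs≡cartesianProductWith : (xs : List A) (d : ℕ) →
  allVecs xs (suc d) ≡ cartesianProductWith _∷_ xs (allVecs xs d)
allVecs≡cartesianProductWith xs d = go xs
  where
  go : ∀ zs → concatMap (λ a → map (a ∷_) (allVecs xs d)) zs ≡ cartesianProductWith _∷_ zs (allVecs xs d)
  go [] = refl
  go (z ∷ zs) = cong (map (z ∷_) (allVecs xs d) ++_) (go zs)

length-allVecs : (xs : List A) (d : ℕ) → length (allVecs xs d) ≡ length xs ^ d
length-allVecs xs zero = refl
length-allVecs xs (suc d) rewrite allVecs≡cartesianProductWith xs d =
  trans (length-cartesianProductWith _∷_ xs (allVecs xs d)) (cong (length xs *_) (length-allVecs xs d))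

allVecs-unique : {xs : List A} → Unique xs → ∀ d → Unique (allVecs xs d)
allVecs-unique u zero = [] ∷ []
allVecs-unique {xs = xs} u (suc d) rewrite allVecs≡cartesianProductWith xs d =
  Unique.cartesianProductWith⁺ _∷_ Vec.∷-injective u (allVecs-unique u d)

∈-allVecs : {xs : List A} → (∀ a → a ∈ xs) → ∀ {d} (v : Vec A d) → v ∈ allVecs xs d
∈-allVecs all [] = here refl
∈-allVecs {xs = xs} all {suc d} (a ∷ v) rewrite allVecs≡cartesianProductWith xs d =
  ∈-cartesianProductWith⁺ _∷_ (all a) (∈-allVecs all v)

-- Greedy choice of compatible candidates.

-- Picking x rules out the candidates in excluded x.
module Greedy {A : Set} (_≟_ : DecidableEquality A) (excluded : A → List A) where
  open DecMembership _≟_ using (_∈?_)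

  Compatible : A → A → Set
  Compatible x y = y ∉ excluded x

  remaining : A → List A → List A
  remaining x = filter (λ y → ¬? (y ∈? excluded x))

  -- Picks follow the order of the candidate list, so that a set of picks is listed in one order
  -- only and counting lists amounts to counting sets.
  selections : List A → ℕ → List (List A)
  selections xs       zero    = [] ∷ []
  selections []       (suc t) = []
  selections (x ∷ xs) (suc t) = map (x ∷_) (selections (remaining x xs) t) ++ selections xs (suc t)

  remaining-⊆ : ∀ {x} xs → remaining x xs ⊆ xs
  remaining-⊆ xs = proj₁ ∘ ∈-filter⁻ _ {xs = xs}

  remaining-unique : ∀ {x xs} → Unique xs → Unique (remaining x xs)
  remaining-unique = Unique.filter⁺ _

  selections-⊆ : ∀ xs t {ys} → ys ∈ selections xs t → ys ⊆ xs
  selections-⊆ xs zero (here refl) ()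
  selections-⊆ (x ∷ xs) (suc t) ys∈ y∈ with ∈-++⁻ (map (x ∷_) (selections (remaining x xs) t)) ys∈
  ... | inj₂ ys∈′ = there (selections-⊆ xs (suc t) ys∈′ y∈)
  ... | inj₁ ys∈′ with ∈-map⁻ (x ∷_) ys∈′
  ... | zs , zs∈ , refl with y∈
  ... | here eq = here eq
  ... | there y∈zs = there (remaining-⊆ xs (selections-⊆ _ t zs∈ y∈zs))

  selections-compatible : ∀ xs t {ys} → ys ∈ selections xs t → AllPairs Compatible ys
  selections-compatible xs zero (here refl) = []
  selections-compatible (x ∷ xs) (suc t) ys∈ with ∈-++⁻ (map (x ∷_) (selections (remaining x xs) t)) ys∈
  ... | inj₂ ys∈′ = selections-compatible xs (suc t) ys∈′
  ... | inj₁ ys∈′ with ∈-map⁻ (x ∷_) ys∈′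
  ... | zs , zs∈ , refl =
    All.tabulate (λ z∈ → proj₂ (∈-filter⁻ _ {xs = xs} (selections-⊆ _ t zs∈ z∈))) ∷ selections-compatible _ t zs∈

  selections-unique : ∀ {xs} → Unique xs → ∀ t → Unique (selections xs t)
  selections-unique u zero = [] ∷ []
  selections-unique {[]} u (suc t) = []
  selections-unique {x ∷ xs} u@(_ ∷ us) (suc t) = Unique.++⁺
    (Unique.map⁺ (λ { refl → refl }) (selections-unique (remaining-unique us) t))
    (selections-unique us (suc t))
    λ { (ys∈ , ys∈′) → Unique.Unique[x∷xs]⇒x∉xs u (selections-⊆ xs (suc t) ys∈′ (∈-map∷⁻ ys∈)) }

  -- A shift reveals only which cubes were chosen; since picks follow the order of `xs`, that
  -- already determines the list.
  selections-ext : ∀ {xs} → Unique xs → ∀ t {ys zs} → ys ∈ selections xs t → zs ∈ selections xs t →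
    ys ⊆ zs → zs ⊆ ys → ys ≡ zs
  selections-ext u zero (here refl) (here refl) _ _ = refl
  selections-ext {x ∷ xs} u@(_ ∷ us) (suc t) ys∈ zs∈ ys⊆zs zs⊆ys
    with ∈-++⁻ (map (x ∷_) (selections (remaining x xs) t)) ys∈
       | ∈-++⁻ (map (x ∷_) (selections (remaining x xs) t)) zs∈
  ... | inj₂ ys∈′ | inj₂ zs∈′ = selections-ext us (suc t) ys∈′ zs∈′ ys⊆zs zs⊆ys
  ... | inj₁ ys∈′ | inj₂ zs∈′ =
    contradiction (selections-⊆ xs (suc t) zs∈′ (ys⊆zs (∈-map∷⁻ ys∈′))) (Unique.Unique[x∷xs]⇒x∉xs u)
  ... | inj₂ ys∈′ | inj₁ zs∈′ =
    contradiction (selections-⊆ xs (suc t) ys∈′ (zs⊆ys (∈-map∷⁻ zs∈′))) (Unique.Unique[x∷xs]⇒x∉xs u)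
  ... | inj₁ ys∈′ | inj₁ zs∈′ with ∈-map⁻ (x ∷_) ys∈′ | ∈-map⁻ (x ∷_) zs∈′
  ... | ys′ , ys′∈ , refl | zs′ , zs′∈ , refl = cong (x ∷_)
    (selections-ext (remaining-unique us) t ys′∈ zs′∈ (tails ys′∈ ys⊆zs) (tails zs′∈ zs⊆ys))
    where
    -- `x` occurs once in the candidate list, hence not among the later picks, so the inclusions
    -- survive its removal.
    tails : ∀ {as bs} → as ∈ selections (remaining x xs) t → x ∷ as ⊆ x ∷ bs → as ⊆ bs
    tails as∈ as⊆bs a∈ with as⊆bs (there a∈)
    ... | there a∈bs = a∈bs
    ... | here refl = contradiction (remaining-⊆ xs (selections-⊆ _ t as∈ a∈)) (Unique.Unique[x∷xs]⇒x∉xs u)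

  length-remaining : ∀ {xs} x → Unique xs → length xs ≤ length (excluded x) + length (remaining x xs)
  length-remaining {xs} x u = subst (length xs ≤_) (length-++ (excluded x))
    (injection⇒length≤ {ys = excluded x ++ remaining x xs} id u into (λ _ _ eq → eq))
    where
    into : ∀ {y} → y ∈ xs → y ∈ excluded x ++ remaining x xs
    into {y} y∈ with y ∈? excluded x
    ... | yes y∈e = ∈-++⁺ˡ y∈e
    ... | no  y∉e = ∈-++⁺ʳ (excluded x) (∈-filter⁺ _ y∈ y∉e)

  module _ (E : ℕ) (excluded≤E : ∀ x → length (excluded x) ≤ E) (r : ℕ) where

    -- A round passes over or picks at most `r` candidates and excludes at most `E`: hence the
    -- budget of `E + r` per pick.
    length-selections : ∀ t {xs} → Unique xs → t * (E + r) ≤ length xs → r ^ t ≤ length (selections xs t)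
    private
      -- Each of the first j candidates, taken as the first pick, leaves enough of them for t further picks.
      first-pick : ∀ t j {xs} → Unique xs → E + j + t * (E + r) ≤ length xs → j ≤ r →
        j * r ^ t ≤ length (selections xs (suc t))

    length-selections zero u h = ℕ.≤-refl
    length-selections (suc t) u h = first-pick t r u h ℕ.≤-refl

    first-pick t zero u h j≤r = z≤n
    first-pick t (suc j) {[]} u h j≤r rewrite ℕ.+-suc E j with () ← h
    first-pick t (suc j) {x ∷ xs} u@(_ ∷ us) h j<r = begin
      r ^ t + j * r ^ t                                              ≤⟨ ℕ.+-mono-≤ (length-selections t (remaining-unique us) enough)
                                                                          (first-pick t j us h′ (ℕ.<⇒≤ j<r)) ⟩
      length (selections (remaining x xs) t) + length (selections xs (suc t))
                                                                     ≡⟨ cong (_+ length (selections xs (suc t))) (length-map (x ∷_) (selections (remaining x xs) t)) ⟨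
      length (map (x ∷_) (selections (remaining x xs) t)) + length (selections xs (suc t))
                                                                     ≡⟨ length-++ (map (x ∷_) (selections (remaining x xs) t)) ⟨
      length (selections (x ∷ xs) (suc t))                           ∎
      where
      open ℕ.≤-Reasoning
      h′ : E + j + t * (E + r) ≤ length xs
      h′ = ℕ.≤-pred (subst (λ n → n + t * (E + r) ≤ suc (length xs)) (ℕ.+-suc E j) h)
      -- The candidates after `x` number at least `E + t * (E + r)`, and picking `x` removes at most
      -- `E` of them.
      enough : t * (E + r) ≤ length (remaining x xs)
      enough = ℕ.+-cancelˡ-≤ E _ _ (begin
        E + t * (E + r)                               ≤⟨ ℕ.+-monoˡ-≤ _ (ℕ.m≤m+n E j) ⟩
        E + j + t * (E + r)                           ≤⟨ h′ ⟩
        length xs                                     ≤⟨ length-remaining x us ⟩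
        length (excluded x) + length (remaining x xs) ≤⟨ ℕ.+-monoˡ-≤ _ (excluded≤E x) ⟩
        E + length (remaining x xs)                   ∎)

-- Axis-aligned planes.

-- An inductive form of `inPlane`, polymorphic in the alphabet because it serves both for words over
-- `Fin (p ^ k)` and for their layers over `Fin p`.
data Agree {A : Set} : ∀ {d} → Vec Bool d → Vec A d → Vec A d → Set where
  []    : Agree [] [] []
  free  : ∀ {d} {S : Vec Bool d} {x y xs ys} → Agree S xs ys → Agree (true ∷ S) (x ∷ xs) (y ∷ ys)
  fixed : ∀ {d} {S : Vec Bool d} {x xs ys} → Agree S xs ys → Agree (false ∷ S) (x ∷ xs) (x ∷ ys)

Agree-free⁻ : ∀ {A d} {S : Vec Bool d} {a b : A} {x y} → Agree (true ∷ S) (a ∷ x) (b ∷ y) → Agree S x y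
Agree-free⁻ (free a) = a

Agree-fixed⁻ : ∀ {A d} {S : Vec Bool d} {a b : A} {x y} → Agree (false ∷ S) (a ∷ x) (b ∷ y) → a ≡ b × Agree S x y
Agree-fixed⁻ (fixed a) = refl , a

Agree-sym : ∀ {A d} {S : Vec Bool d} {x y : Vec A d} → Agree S x y → Agree S y x
Agree-sym []        = []
Agree-sym (free a)  = free (Agree-sym a)
Agree-sym (fixed a) = fixed (Agree-sym a)

Agree-trans : ∀ {A d} {S : Vec Bool d} {x y z : Vec A d} → Agree S x y → Agree S y z → Agree S x z
Agree-trans []        []        = []
Agree-trans (free a)  (free b)  = free (Agree-trans a b)
Agree-trans (fixed a) (fixed b) = fixed (Agree-trans a b)

-- Linear algebra over a commutative ring.

module Linear {F : Set} {_+_ _*_ : Op₂ F} { -_ : Op₁ F} {0# 1# : F}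
  (isCR : IsCommutativeRing _≡_ _+_ _*_ -_ 0# 1#) where

  R : CommutativeRing _ _
  R = record { isCommutativeRing = isCR }
  open CommutativeRing R using (ring; commutativeSemiring; +-group; +-identityʳ; +-identityˡ; *-identityˡ; zeroʳ;
    -‿inverseˡ; -‿inverseʳ; +-assoc; +-comm; *-assoc)
  open Algebra.Properties.Ring ring using (-‿distribˡ-*; -‿distribʳ-*)
  open Algebra.Properties.Group +-group using (∙-cancelˡ; ∙-cancelʳ)
  open Algebra.Solver.Ring.NaturalCoefficients.Default commutativeSemiring using (solve; _:=_; _:+_; _:*_; con)

  infixl 6 _-_
  _-_ : Op₂ F
  a - b = a + (- b)

  a-b+b : ∀ a b → (a - b) + b ≡ a
  a-b+b a b = trans (+-assoc a _ b) (trans (cong (a +_) (-‿inverseˡ b)) (+-identityʳ a))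

  a+[b-a] : ∀ a b → a + (b - a) ≡ b
  a+[b-a] a b = trans (+-comm a _) (a-b+b b a)

  dot : ∀ {d} → Vec F d → Vec F d → F
  dot []       []       = 0#
  dot (r ∷ rs) (x ∷ xs) = (r * x) + dot rs xs

  -- The update y + c z, named after the BLAS routine: translations of words and messages are
  -- written with it.
  axpy : ∀ {d} → F → Vec F d → Vec F d → Vec F d
  axpy c = zipWith (λ a y → y + (c * a))

  dot-axpy : ∀ {d} (r : Vec F d) c z y → dot r (axpy c z y) ≡ dot r y + (c * dot r z)
  dot-axpy [] c [] [] = solve 1 (λ c → con 0 := con 0 :+ c :* con 0) refl c
  dot-axpy (r ∷ rs) c (z ∷ zs) (y ∷ ys) rewrite dot-axpy rs c zs ys =
    solve 6 (λ r y c z A B → r :* (y :+ c :* z) :+ (A :+ c :* B) := r :* y :+ A :+ c :* (r :* z :+ B)) refl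
      r y c z (dot rs ys) (dot rs zs)

  axpy-+ : ∀ {d} a b (z y : Vec F d) → axpy a z (axpy b z y) ≡ axpy (b + a) z y
  axpy-+ a b [] [] = refl
  axpy-+ a b (z ∷ zs) (y ∷ ys) = cong₂ _∷_
    (solve 4 (λ a b z y → y :+ b :* z :+ a :* z := y :+ (b :+ a) :* z) refl a b z y) (axpy-+ a b zs ys)

  axpy-0 : ∀ {d} (z y : Vec F d) → axpy 0# z y ≡ y
  axpy-0 [] [] = refl
  axpy-0 (z ∷ zs) (y ∷ ys) = cong₂ _∷_ (solve 2 (λ z y → y :+ con 0 :* z := y) refl z y) (axpy-0 zs ys)

  axpy-zeroʳ : ∀ {d} c (y : Vec F d) → axpy c (replicate d 0#) y ≡ y
  axpy-zeroʳ c []       = refl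
  axpy-zeroʳ c (y ∷ ys) = cong₂ _∷_ (solve 2 (λ c y → y :+ c :* con 0 := y) refl c y) (axpy-zeroʳ c ys)

  -- On a cube of slope `c`, translating a higher layer by `c` times `a` amounts to translating
  -- layer 0 by `a`. The factor `1#` is the first digit of the direction.
  axpy-axpy : ∀ {d} c (a f g : Vec F d) → axpy c a (axpy c f g) ≡ axpy c (axpy 1# a f) g
  axpy-axpy c [] [] [] = refl
  axpy-axpy c (a ∷ as) (f ∷ fs) (g ∷ gs) = cong₂ _∷_ (begin
      (g + (c * f)) + (c * a)   ≡⟨ solve 4 (λ c a f g → g :+ c :* f :+ c :* a := g :+ c :* (f :+ a)) refl c a f g ⟩
      g + (c * (f + a))         ≡⟨ cong (λ e → g + (c * (f + e))) (*-identityˡ a) ⟨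
      g + (c * (f + (1# * a)))  ∎) (axpy-axpy c as fs gs)
    where open ≡-Reasoning

  axpy-cancel : ∀ {d} c (z y : Vec F d) → axpy c z (axpy (- c) z y) ≡ y
  axpy-cancel c z y = trans (axpy-+ c (- c) z y) (trans (cong (λ e → axpy e z y) (-‿inverseˡ c)) (axpy-0 z y))

  axpy-cancel′ : ∀ {d} c (z y : Vec F d) → axpy (- c) z (axpy c z y) ≡ y
  axpy-cancel′ c z y = trans (axpy-+ (- c) c z y) (trans (cong (λ e → axpy e z y) (-‿inverseʳ c)) (axpy-0 z y))

  axpy-neg : ∀ {d} c (z y : Vec F d) → axpy (- c) z y ≡ axpy c (Vec.map -_ z) y
  axpy-neg c [] [] = refl
  axpy-neg c (z ∷ zs) (y ∷ ys) = cong₂ (λ e es → (y + e) ∷ es)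
    (trans (sym (-‿distribˡ-* c z)) (-‿distribʳ-* c z)) (axpy-neg c zs ys)

  -- `z` lies in the parallel plane through 0, so it vanishes on the fixed coordinates.
  Agree-axpy : ∀ {d} {S : Vec Bool d} {x y z} c → Agree S x y → Agree S (replicate d 0#) z → Agree S x (axpy c z y)
  Agree-axpy c [] [] = []
  Agree-axpy c (free a) (free b) = free (Agree-axpy c a b)
  Agree-axpy c (fixed {x = x} a) (fixed b) =
    subst (λ e → Agree _ _ (e ∷ _)) (solve 2 (λ x c → x := x :+ c :* con 0) refl x c) (fixed (Agree-axpy c a b))

  -- Any `t` columns of the first `t` rows form an invertible matrix: the condition for a parity
  -- check matrix of an MDS code of distance `t + 1`. Rows are indexed by ℕ so that one `H` can
  -- serve for several `t`.
  record Solvable {d} (t : ℕ) (H : ℕ → Vec F d) : Set where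
    field
      solution : ∀ {S} → numTrue S ≡ t → ∀ x (b : ℕ → F) → ∃ λ y → Agree S x y × (∀ {j} → j < t → dot (H j) y ≡ b j)
      unique   : ∀ {S} → numTrue S ≡ t → ∀ {x y} → Agree S x y →
                 (∀ {j} → j < t → dot (H j) x ≡ dot (H j) y) → x ≡ y

  -- Generalised Vandermonde matrices over a field.

  module GeneralisedVandermonde (inverse : ∀ a → a ≢ 0# → ∃ λ b → b * a ≡ 1#) where

    -- The column (w , α) has the entries w, w α, w α², …
    Column : Set
    Column = F × F

    entry : ℕ → Column → F
    entry zero    (w , α) = w
    entry (suc j) (w , α) = α * entry j (w , α)

    row : ∀ {n} → ℕ → Vec Column n → Vec F n
    row j = Vec.map (entry j)

    -- Subtracting α times row j from row j + 1 kills a column with node α.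
    eliminate : F → Column → Column
    eliminate α (w , β) = w * (β - α) , β

    entry-eliminate : ∀ α c j → entry j (eliminate α c) + (α * entry j c) ≡ entry (suc j) c
    entry-eliminate α (w , β) zero = begin
      (w * (β - α)) + (α * w)   ≡⟨ solve 3 (λ w δ α → w :* δ :+ α :* w := (δ :+ α) :* w) refl w (β - α) α ⟩
      ((β - α) + α) * w         ≡⟨ cong (_* w) (a-b+b β α) ⟩
      β * w                     ∎ where open ≡-Reasoning
    entry-eliminate α c@(w , β) (suc j) = begin
      (β * entry j (eliminate α c)) + (α * (β * entry j c))
        ≡⟨ solve 4 (λ β α X C → β :* X :+ α :* (β :* C) := β :* (X :+ α :* C)) refl β α (entry j (eliminate α c)) (entry j c) ⟩
      β * (entry j (eliminate α c) + (α * entry j c))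
        ≡⟨ cong (β *_) (entry-eliminate α c j) ⟩
      β * (β * entry j c) ∎ where open ≡-Reasoning

    dot-eliminate : ∀ {n} α (cs : Vec Column n) j x →
      dot (row j (Vec.map (eliminate α) cs)) x + (α * dot (row j cs) x) ≡ dot (row (suc j) cs) x
    dot-eliminate α [] j [] = solve 1 (λ α → con 0 :+ α :* con 0 := con 0) refl α
    dot-eliminate α (c ∷ cs) j (x ∷ xs) = begin
      ((E * x) + P) + (α * ((C * x) + Q))
        ≡⟨ solve 6 (λ E x P α C Q → E :* x :+ P :+ α :* (C :* x :+ Q) := (E :+ α :* C) :* x :+ (P :+ α :* Q)) refl E x P α C Q ⟩
      ((E + (α * C)) * x) + (P + (α * Q))
        ≡⟨ cong₂ (λ u v → (u * x) + v) (entry-eliminate α c j) (dot-eliminate α cs j xs) ⟩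
      (entry (suc j) c * x) + dot (row (suc j) cs) xs ∎
      where
      open ≡-Reasoning
      E = entry j (eliminate α c)
      C = entry j c
      P = dot (row j (Vec.map (eliminate α) cs)) xs
      Q = dot (row j cs) xs

    -- The first column has node `α`, so it cancels from row `j + 1` minus `α` times row `j`; what
    -- remains is a system in `xs` alone.
    dot-eliminate-∷ : ∀ {n} w α (cs : Vec Column n) j x xs →
      dot (row j (Vec.map (eliminate α) cs)) xs + (α * dot (row j ((w , α) ∷ cs)) (x ∷ xs)) ≡
      dot (row (suc j) ((w , α) ∷ cs)) (x ∷ xs)
    dot-eliminate-∷ w α cs j x xs = begin
      P + (α * ((C * x) + Q))        ≡⟨ solve 5 (λ P α C x Q → P :+ α :* (C :* x :+ Q) := α :* C :* x :+ (P :+ α :* Q)) refl P α C x Q ⟩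
      ((α * C) * x) + (P + (α * Q))  ≡⟨ cong (((α * C) * x) +_) (dot-eliminate α cs j xs) ⟩
      ((α * C) * x) + dot (row (suc j) cs) xs ∎
      where
      open ≡-Reasoning
      C = entry j (w , α)
      P = dot (row j (Vec.map (eliminate α) cs)) xs
      Q = dot (row j cs) xs

    NonZeroWeights DistinctNodes : ∀ {n} → Vec Column n → Set
    NonZeroWeights = VecAll (λ c → proj₁ c ≢ 0#)
    DistinctNodes  = VecAllPairs (_≢_ on proj₂)

    -- For a single row the nodes do not matter: this covers parity check codes of any length.
    GeneralPosition : ∀ {n} → ℕ → Vec Column n → Set
    GeneralPosition zero          cs = ⊤
    GeneralPosition (suc zero)    cs = NonZeroWeights cs
    GeneralPosition (suc (suc t)) cs = NonZeroWeights cs × DistinctNodes cs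

    generalPosition-weights : ∀ {n} t {cs : Vec Column n} → GeneralPosition (suc t) cs → NonZeroWeights cs
    generalPosition-weights zero    g = g
    generalPosition-weights (suc t) g = proj₁ g

    generalPosition-tail : ∀ {n} t {c} {cs : Vec Column n} → GeneralPosition t (c ∷ cs) → GeneralPosition t cs
    generalPosition-tail zero          g = tt
    generalPosition-tail (suc zero)    (_ ∷ g) = g
    generalPosition-tail (suc (suc t)) (_ ∷ g , _ ∷ h) = g , h

    a*b≢0 : ∀ {a b} → a ≢ 0# → b ≢ 0# → a * b ≢ 0#
    a*b≢0 {a} {b} a≢0 b≢0 ab≡0 with i , ia≡1 ← inverse a a≢0 = b≢0 (begin
      b             ≡⟨ *-identityˡ b ⟨
      1# * b        ≡⟨ cong (_* b) ia≡1 ⟨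
      (i * a) * b   ≡⟨ *-assoc i a b ⟩
      i * (a * b)   ≡⟨ cong (i *_) ab≡0 ⟩
      i * 0#        ≡⟨ zeroʳ i ⟩
      0#            ∎) where open ≡-Reasoning

    a-b≢0 : ∀ {a b} → b ≢ a → a - b ≢ 0#
    a-b≢0 {a} {b} b≢a eq = b≢a (trans (sym (+-identityˡ b)) (trans (cong (_+ b) (sym eq)) (a-b+b a b)))

    -- The new weights w (β - α) are non-zero because the nodes differ and a field has no zero
    -- divisors; the nodes do not change.
    generalPosition-eliminate : ∀ {n} t {w α} {cs : Vec Column n} →
      GeneralPosition (suc t) ((w , α) ∷ cs) → GeneralPosition t (Vec.map (eliminate α) cs)
    generalPosition-eliminate zero    g = tt
    generalPosition-eliminate (suc t) {α = α} {cs} (_ ∷ ws , α≢ ∷ ds) = result t weights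
      where
      weights : NonZeroWeights (Vec.map (eliminate α) cs)
      weights = VecAll.map⁺ (VecAll.map (λ (w≢0 , α≢β) → a*b≢0 w≢0 (a-b≢0 α≢β)) (VecAll.zip (ws , α≢)))
      result : ∀ t → NonZeroWeights (Vec.map (eliminate α) cs) → GeneralPosition (suc t) (Vec.map (eliminate α) cs)
      result zero    ws = ws
      result (suc t) ws = ws , VecAllPairs.map⁺ ds

    -- Gaussian elimination, column by column: a fixed coordinate moves to the right-hand side, and
    -- a free one is eliminated together with one row.
    vandermonde-solvable : ∀ {n} t (cs : Vec Column n) → GeneralPosition t cs → Solvable t (λ j → row j cs)
    vandermonde-solvable t cs g = record { solution = λ #S x b → exists cs g #S x b ; unique = only cs g }
      where
      exists : ∀ {n t} (cs : Vec Column n) → GeneralPosition t cs → ∀ {S} → numTrue S ≡ t → ∀ x (b : ℕ → F) →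
        ∃ λ y → Agree S x y × (∀ {j} → j < t → dot (row j cs) y ≡ b j)
      exists [] g {[]} refl [] b = [] , [] , λ ()
      exists {t = t} (c ∷ cs) g {false ∷ S} #S (x ∷ xs) b
        with y , agree , eq ← exists cs (generalPosition-tail t g) #S xs (λ j → b j - (entry j c * x)) =
        x ∷ y , fixed agree , λ j<t → trans (cong (_ +_) (eq j<t)) (a+[b-a] _ _)
      -- The remaining coordinates solve the eliminated system; row 0, whose leading entry `w` is
      -- invertible, then yields `y₀`.
      exists ((w , α) ∷ cs) g {true ∷ S} refl (x ∷ xs) b
        with i , iw≡1 ← inverse w (VecAll.head (generalPosition-weights _ g))
        with y , agree , eq ← exists (Vec.map (eliminate α) cs) (generalPosition-eliminate _ g) {S} refl xs (λ j → b (suc j) - (α * b j)) =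
        y₀ ∷ y , free agree , λ j<t → full _ j<t
        where
        open ≡-Reasoning
        Q = b 0 - dot (row 0 cs) y
        y₀ = i * Q
        full : ∀ j → j < suc (numTrue S) → dot (row j ((w , α) ∷ cs)) (y₀ ∷ y) ≡ b j
        full zero _ = begin
          (w * (i * Q)) + dot (row 0 cs) y   ≡⟨ cong (_+ dot (row 0 cs) y) (solve 3 (λ w i Q → w :* (i :* Q) := i :* w :* Q) refl w i Q) ⟩
          ((i * w) * Q) + dot (row 0 cs) y   ≡⟨ cong (λ e → (e * Q) + dot (row 0 cs) y) iw≡1 ⟩
          (1# * Q) + dot (row 0 cs) y        ≡⟨ cong (_+ dot (row 0 cs) y) (*-identityˡ Q) ⟩
          Q + dot (row 0 cs) y               ≡⟨ a-b+b _ _ ⟩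
          b 0                                ∎
        -- Row `j + 1` is the eliminated row `j` plus `α` times row `j`, which holds by recursion.
        full (suc j) (s<s j<t) = begin
          dot (row (suc j) ((w , α) ∷ cs)) (y₀ ∷ y)   ≡⟨ dot-eliminate-∷ w α cs j y₀ y ⟨
          dot (row j (Vec.map (eliminate α) cs)) y + (α * dot (row j ((w , α) ∷ cs)) (y₀ ∷ y))
                                                      ≡⟨ cong₂ (λ u v → u + (α * v)) (eq j<t) (full j (ℕ.<⇒≤ (s<s j<t))) ⟩
          (b (suc j) - (α * b j)) + (α * b j)         ≡⟨ a-b+b _ _ ⟩
          b (suc j)                                   ∎
      only : ∀ {n t} (cs : Vec Column n) → GeneralPosition t cs → ∀ {S} → numTrue S ≡ t → ∀ {x y} → Agree S x y →
        (∀ {j} → j < t → dot (row j cs) x ≡ dot (row j cs) y) → x ≡ y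
      only [] g #S [] eq = refl
      only {t = t} (c ∷ cs) g #S (fixed agree) eq =
        cong (_ ∷_) (only cs (generalPosition-tail t g) #S agree (λ j<t → ∙-cancelˡ _ _ _ (eq j<t)))
      -- Equality on consecutive rows gives equality on the eliminated rows, hence of the tails; row
      -- 0 then gives the first coordinates.
      only ((w , α) ∷ cs) g {true ∷ S} refl {x ∷ xs} {y ∷ ys} (free agree) eq
        with i , iw≡1 ← inverse w (VecAll.head (generalPosition-weights _ g))
        with refl ← only (Vec.map (eliminate α) cs) (generalPosition-eliminate _ g) {S} refl agree (λ {j} j<t →
          ∙-cancelʳ (α * dot (row j ((w , α) ∷ cs)) (x ∷ xs)) _ _
            (trans (dot-eliminate-∷ w α cs j x xs) (trans (eq (s<s j<t)) (trans (sym (dot-eliminate-∷ w α cs j y ys))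
              (cong (λ e → dot (row j (Vec.map (eliminate α) cs)) ys + (α * e)) (sym (eq (ℕ.<⇒≤ (s<s j<t)))))))))
        = cong (_∷ _) (trans (sym (undo x)) (trans (cong (i *_) (∙-cancelʳ _ _ _ (eq z<s))) (undo y)))
        where
        undo : ∀ v → i * (w * v) ≡ v
        undo v = trans (sym (*-assoc i w v)) (trans (cong (_* v) iw≡1) (*-identityˡ v))

    δ : ℕ → ℕ → F
    δ i j = if i ≡ᵇ j then 1# else 0#

    δ-refl : ∀ i → δ i i ≡ 1#
    δ-refl zero    = refl
    δ-refl (suc i) = δ-refl i

    δ-< : ∀ {i j} → i < j → δ i j ≡ 0#
    δ-< {zero}  {suc j} _         = refl
    δ-< {suc i} {suc j} (s<s i<j) = δ-< i<j

    -- The extra column (0, …, 0, 1) is the node at infinity.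
    extend-solvable : ∀ {n} t (H : ℕ → Vec F n) → Solvable t H → Solvable (suc t) H →
      Solvable (suc t) (λ j → δ j t ∷ H j)
    extend-solvable t H lower upper = record { solution = exists ; unique = only }
      where
      module L = Solvable lower
      module U = Solvable upper
      open ≡-Reasoning
      exists : ∀ {S} → numTrue S ≡ suc t → ∀ x (b : ℕ → F) →
        ∃ λ y → Agree S x y × (∀ {j} → j < suc t → dot (δ j t ∷ H j) y ≡ b j)
      -- A fixed extra coordinate only alters the right-hand sides, so `upper` applies.
      exists {false ∷ S} #S (x ∷ xs) b with y , agree , eq ← U.solution #S xs (λ j → b j - (δ j t * x)) =
        x ∷ y , fixed agree , λ j<t → trans (cong (_ +_) (eq j<t)) (a+[b-a] _ _)
      -- The first `t` rows vanish in the extra coordinate, so `lower` solves them with the other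
      -- `t` free ones; row `t` then determines `y₀`.
      exists {true ∷ S} #S (x ∷ xs) b with y , agree , eq ← L.solution (ℕ.suc-injective #S) xs b =
        y₀ ∷ y , free agree , λ j≤t → full (ℕ.m<1+n⇒m<n∨m≡n j≤t)
        where
        y₀ = b t - dot (H t) y
        full : ∀ {j} → _ → dot (δ j t ∷ H j) (y₀ ∷ y) ≡ b j
        full {j} (inj₁ j<t) = begin
          (δ j t * y₀) + dot (H j) y ≡⟨ cong₂ (λ u v → (u * y₀) + v) (δ-< j<t) (eq j<t) ⟩
          (0# * y₀) + b j            ≡⟨ solve 2 (λ y b → con 0 :* y :+ b := b) refl y₀ (b j) ⟩
          b j                        ∎
        full (inj₂ refl) = begin
          (δ t t * y₀) + dot (H t) y ≡⟨ cong (λ u → (u * y₀) + dot (H t) y) (δ-refl t) ⟩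
          (1# * y₀) + dot (H t) y    ≡⟨ cong (_+ dot (H t) y) (*-identityˡ y₀) ⟩
          y₀ + dot (H t) y           ≡⟨ a-b+b _ _ ⟩
          b t                        ∎
      only : ∀ {S} → numTrue S ≡ suc t → ∀ {x y} → Agree S x y →
        (∀ {j} → j < suc t → dot (δ j t ∷ H j) x ≡ dot (δ j t ∷ H j) y) → x ≡ y
      only #S (fixed agree) eq = cong (_ ∷_) (U.unique #S agree (λ j<t → ∙-cancelˡ _ _ _ (eq j<t)))
      only #S {x ∷ xs} {y ∷ ys} (free agree) eq with refl ← L.unique (ℕ.suc-injective #S) agree (λ {j} j<t → begin
          dot (H j) xs               ≡⟨ solve 2 (λ x A → A := con 0 :* x :+ A) refl x _ ⟩
          (0# * x) + dot (H j) xs    ≡⟨ cong (λ u → (u * x) + dot (H j) xs) (δ-< j<t) ⟨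
          (δ j t * x) + dot (H j) xs ≡⟨ eq (ℕ.<⇒≤ (s<s j<t)) ⟩
          (δ j t * y) + dot (H j) ys ≡⟨ cong (λ u → (u * y) + dot (H j) ys) (δ-< j<t) ⟩
          (0# * y) + dot (H j) ys    ≡⟨ solve 2 (λ x A → A := con 0 :* x :+ A) refl y _ ⟨
          dot (H j) ys               ∎) = cong (_∷ _) (begin
          x         ≡⟨ *-identityˡ x ⟨
          1# * x    ≡⟨ cong (_* x) (δ-refl t) ⟨
          δ t t * x ≡⟨ ∙-cancelʳ _ _ _ (eq ℕ.≤-refl) ⟩
          δ t t * y ≡⟨ cong (_* y) (δ-refl t) ⟩
          1# * y    ≡⟨ *-identityˡ y ⟩
          y         ∎)

-- From Boolean tests to propositions.

⌊⌋-true⁺ : {A : Set} (a? : Dec A) → A → ⌊ a? ⌋ ≡ true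
⌊⌋-true⁺ a? a = Equivalence.to T-≡ (fromWitness {a? = a?} a)

==ᴺ⇒≡ : ∀ m n → (m ==ᴺ n) ≡ true → m ≡ n
==ᴺ⇒≡ zero    zero    _  = refl
==ᴺ⇒≡ (suc m) (suc n) eq = cong suc (==ᴺ⇒≡ m n eq)

inPlane⁺ : ∀ {q d} {S : Vec Bool d} {x y : Point q d} → Agree S x y → inPlane S x y ≡ true
inPlane⁺ [] = refl
inPlane⁺ (free a) = inPlane⁺ a
inPlane⁺ (fixed {x = x} a) rewrite ⌊⌋-true⁺ (x ≟ x) refl = inPlane⁺ a

inPlane⁻ : ∀ {q d} (S : Vec Bool d) (x y : Point q d) → inPlane S x y ≡ true → Agree S x y
inPlane⁻ [] [] [] _ = []
inPlane⁻ (true ∷ S) (a ∷ x) (b ∷ y) eq = free (inPlane⁻ S x y eq)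
inPlane⁻ (false ∷ S) (a ∷ x) (b ∷ y) eq with a ≟ b
... | yes refl = fixed (inPlane⁻ S x y eq)
... | no  _    with () ← eq

allPoints-unique : ∀ q d → Unique (allPoints q d)
allPoints-unique q d = allVecs-unique (Unique.allFin⁺ q) d

∈-allPoints : ∀ {q d} (x : Point q d) → x ∈ allPoints q d
∈-allPoints = ∈-allVecs ∈-allFin

funToFin-cong : ∀ {n p} {f g : Fin n → Fin p} → f ≗ g → funToFin f ≡ funToFin g
funToFin-cong {zero}  f≗g = refl
funToFin-cong {suc n} f≗g = cong₂ combine (f≗g zero) (funToFin-cong (f≗g ∘ suc))

-- Digits and layers.

-- A symbol of the alphabet Fin (p ^ k) is read as k digits in Fin p, and a word accordingly as k layers.
module Layers (p k : ℕ) where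

  layer : ∀ {d} → Fin k → Point (p ^ k) d → Vec (Fin p) d
  layer l = Vec.map (λ v → finToFun {p} {k} v l)

  assemble : ∀ {d} → (Fin k → Vec (Fin p) d) → Point (p ^ k) d
  assemble ys = tabulate (λ i → funToFin (λ l → lookup (ys l) i))

  layer-assemble : ∀ {d} (ys : Fin k → Vec (Fin p) d) l → layer l (assemble ys) ≡ ys l
  layer-assemble ys l = begin
    Vec.map (λ v → finToFun {p} {k} v l) (tabulate _) ≡⟨ Vec.tabulate-∘ _ _ ⟨
    tabulate _                            ≡⟨ Vec.tabulate-cong (λ i → finToFun-funToFin (λ l → lookup (ys l) i) l) ⟩
    tabulate (lookup (ys l))              ≡⟨ Vec.tabulate∘lookup (ys l) ⟩
    ys l                                  ∎ where open ≡-Reasoning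

  layer-ext : ∀ {d} {x y : Point (p ^ k) d} → (∀ l → layer l x ≡ layer l y) → x ≡ y
  layer-ext {x = []} {[]} eq = refl
  layer-ext {x = a ∷ x} {b ∷ y} eq = cong₂ _∷_
    (begin
      a                             ≡⟨ funToFin-finToFin {k} {p} a ⟨
      funToFin (finToFun {p} {k} a) ≡⟨ funToFin-cong (Vec.∷-injectiveˡ ∘ eq) ⟩
      funToFin (finToFun {p} {k} b) ≡⟨ funToFin-finToFin {k} {p} b ⟩
      b                             ∎)
    (layer-ext (Vec.∷-injectiveʳ ∘ eq))
    where open ≡-Reasoning

  layer-drop : ∀ t {m} l (x : Point (p ^ k) (t + m)) → layer l (drop t x) ≡ drop t (layer l x)
  layer-drop t l x = sym (Vec.drop-map _ t x)

  Agree-layer⁺ : ∀ {d} {S : Vec Bool d} {x y : Point (p ^ k) d} → Agree S x y → ∀ l → Agree S (layer l x) (layer l y)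
  Agree-layer⁺ []        l = []
  Agree-layer⁺ (free a)  l = free (Agree-layer⁺ a l)
  Agree-layer⁺ (fixed a) l = fixed (Agree-layer⁺ a l)

  Agree-layer⁻ : ∀ {d} (S : Vec Bool d) (x y : Point (p ^ k) d) → (∀ l → Agree S (layer l x) (layer l y)) → Agree S x y
  Agree-layer⁻ [] [] [] a = []
  Agree-layer⁻ (true ∷ S) (_ ∷ x) (_ ∷ y) a = free (Agree-layer⁻ S x y (Agree-free⁻ ∘ a))
  Agree-layer⁻ (false ∷ S) (b ∷ x) (c ∷ y) a
    -- Two symbols are equal if all their digits are; as one-letter words they fall under
    -- `layer-ext`.
    with refl ← layer-ext {x = b ∷ []} {c ∷ []} (cong (_∷ []) ∘ proj₁ ∘ Agree-fixed⁻ ∘ a) =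
    fixed (Agree-layer⁻ S x y (proj₂ ∘ Agree-fixed⁻ ∘ a))

Agree-drop⁻ : ∀ {A : Set} t {m} {x y : Vec A (t + m)} → Agree (replicate t true ++ᵛ replicate m false) x y → drop t x ≡ drop t y
Agree-drop⁻ zero {zero} [] = refl
Agree-drop⁻ zero {suc m} (fixed a) = cong (_ ∷_) (Agree-drop⁻ zero a)
Agree-drop⁻ (suc t) (free a) = Agree-drop⁻ t a

numTrue-prefix : ∀ t m → numTrue (replicate t true ++ᵛ replicate m false) ≡ t
numTrue-prefix zero    zero    = refl
numTrue-prefix zero    (suc m) = numTrue-prefix zero m
numTrue-prefix (suc t) m       = cong suc (numTrue-prefix t m)

drop-++ : ∀ {A : Set} t {m} (xs : Vec A t) {ys : Vec A m} → drop t (xs ++ᵛ ys) ≡ ys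
drop-++ zero    []       = refl
drop-++ (suc t) (_ ∷ xs) = drop-++ t xs

-- MDS codes with prescribed syndromes.

module Twisted {p : ℕ} {_⊕_ _⊗_ : Op₂ (Fin p)} {⊖_ : Op₁ (Fin p)} {0# 1# : Fin p}
  (isCR : IsCommutativeRing _≡_ _⊕_ _⊗_ ⊖_ 0# 1#) (k t m : ℕ)
  {H : ℕ → Vec (Fin p) (t + m)} (solvable : Linear.Solvable isCR t H) where

  open Layers p k
  open Linear isCR
  open Solvable solvable
  open IsCommutativeRing isCR using (+-identityˡ; *-identityʳ; -‿inverseʳ)

  -- `s f l` is the common value prescribed for all `t` syndromes of layer `l` when the message is
  -- `f`.
  Shift : Set
  Shift = Point (p ^ k) m → Fin k → Fin p

  -- Here `f′` is f + a ⊗ s(f), given through its layers: layer `l` moves by the multiple `s f l` of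
  -- `a`.
  Invariant : Shift → Set
  Invariant s = ∀ a {f f′} → (∀ l → layer l f′ ≡ axpy (s f l) a (layer l f)) → ∀ l → s f′ l ≡ s f l

  Codeword : Shift → Point (p ^ k) (t + m) → Set
  Codeword s x = ∀ l {j} → j < t → dot (H j) (layer l x) ≡ s (drop t x) l

  codeword? : ∀ s x → Dec (Codeword s x)
  codeword? s x = all? λ l → ℕ.allUpTo? (λ j → dot (H j) (layer l x) ≟ s (drop t x) l) t

  isCodeword : Shift → Point (p ^ k) (t + m) → Bool
  isCodeword s x = ⌊ codeword? s x ⌋

  code : Shift → List (Point (p ^ k) (t + m))
  code s = filter (T? ∘ isCodeword s) (allPoints (p ^ k) (t + m))

  -- Let y be the word of the plane with zero syndrome, and z the vector of syndrome (1, …, 1) supported on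
  -- the free coordinates. A word of the plane whose shift is σ can only be y + σ z; by invariance σ is then
  -- the shift at y, and conversely.
  module Plane {s : Shift} (inv : Invariant s) {S : Vec Bool (t + m)} (#S : numTrue S ≡ t) (x : Point (p ^ k) (t + m)) where

    private
      zSol = solution {S} #S (replicate (t + m) 0#) (λ _ → 1#)
      z = proj₁ zSol
      agree-z = proj₁ (proj₂ zSol)
      Hz≡1 = proj₂ (proj₂ zSol)
      ySol = λ l → solution {S} #S (layer l x) (λ _ → 0#)
      ys = λ l → proj₁ (ySol l)
      y : Point (p ^ k) (t + m)
      y = assemble ys

      layer-drop-y : ∀ l → layer l (drop t y) ≡ drop t (ys l)
      layer-drop-y l = trans (layer-drop t l y) (cong (drop t) (layer-assemble ys l))

      σ : Fin k → Fin p
      σ = s (drop t y)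

    word : Point (p ^ k) (t + m)
    word = assemble (λ l → axpy (σ l) z (ys l))

    layer-word : ∀ l → layer l word ≡ axpy (σ l) z (ys l)
    layer-word = layer-assemble (λ l → axpy (σ l) z (ys l))

    word-agrees : Agree S x word
    word-agrees = Agree-layer⁻ S x word λ l →
      subst (Agree S (layer l x)) (sym (layer-word l)) (Agree-axpy (σ l) (proj₁ (proj₂ (ySol l))) agree-z)

    word-codeword : Codeword s word
    word-codeword l {j} j<t = begin
      dot (H j) (layer l word)               ≡⟨ cong (dot (H j)) (layer-word l) ⟩
      dot (H j) (axpy (σ l) z (ys l))        ≡⟨ dot-axpy (H j) (σ l) z (ys l) ⟩
      dot (H j) (ys l) ⊕ (σ l ⊗ dot (H j) z) ≡⟨ cong₂ (λ u v → u ⊕ (σ l ⊗ v)) (proj₂ (proj₂ (ySol l)) j<t) (Hz≡1 j<t) ⟩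
      0# ⊕ (σ l ⊗ 1#)                        ≡⟨ trans (+-identityˡ _) (*-identityʳ (σ l)) ⟩
      -- `word` is y + σ z, so its message arises from that of `y` by a move along the message part
      -- of `z`, under which `s` is invariant.
      σ l                                    ≡⟨ inv (drop t z) (λ l → begin
        layer l (drop t word)                          ≡⟨ layer-drop t l word ⟩
        drop t (layer l word)                          ≡⟨ cong (drop t) (layer-word l) ⟩
        drop t (axpy (σ l) z (ys l))                   ≡⟨ Vec.drop-zipWith _ z (ys l) ⟩
        axpy (σ l) (drop t z) (drop t (ys l))          ≡⟨ cong (axpy (σ l) (drop t z)) (layer-drop-y l) ⟨
        axpy (σ l) (drop t z) (layer l (drop t y))     ∎) l ⟨
      s (drop t word) l                      ∎ where open ≡-Reasoning

    word-unique : ∀ {x′} → Agree S x x′ → Codeword s x′ → x′ ≡ word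
    word-unique {x′} agree cw = layer-ext λ l → begin
      layer l x′                             ≡⟨ axpy-cancel (τ l) z (layer l x′) ⟨
      axpy (τ l) z (axpy (⊖ τ l) z (layer l x′)) ≡⟨ cong (axpy (τ l) z) (ys≡ l) ⟨
      axpy (τ l) z (ys l)                    ≡⟨ cong (λ c → axpy c z (ys l)) (σ≡τ l) ⟨
      axpy (σ l) z (ys l)                    ≡⟨ layer-word l ⟨
      layer l word                           ∎
      where
      open ≡-Reasoning
      τ : Fin k → Fin p
      τ = s (drop t x′)
      -- Subtracting τ z from `x′` leaves zero syndrome in each layer, without leaving the plane;
      -- only `ys` has this property.
      ys≡ : ∀ l → ys l ≡ axpy (⊖ τ l) z (layer l x′)
      ys≡ l = unique {S} #S
        (Agree-trans (Agree-sym (proj₁ (proj₂ (ySol l)))) (Agree-axpy (⊖ τ l) (Agree-layer⁺ agree l) agree-z))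
        λ {j} j<t → begin
          dot (H j) (ys l)                               ≡⟨ proj₂ (proj₂ (ySol l)) j<t ⟩
          0#                                             ≡⟨ -‿inverseʳ (τ l) ⟨
          τ l ⊕ (⊖ τ l)                                  ≡⟨ cong (τ l ⊕_) (*-identityʳ (⊖ τ l)) ⟨
          τ l ⊕ ((⊖ τ l) ⊗ 1#)                           ≡⟨ cong₂ (λ u v → u ⊕ ((⊖ τ l) ⊗ v)) (cw l j<t) (Hz≡1 j<t) ⟨
          dot (H j) (layer l x′) ⊕ ((⊖ τ l) ⊗ dot (H j) z) ≡⟨ dot-axpy (H j) (⊖ τ l) z (layer l x′) ⟨
          dot (H j) (axpy (⊖ τ l) z (layer l x′))        ∎
      -- Invariance at the message of `x′`, along -z because the move goes from `x′` back to `y`.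
      σ≡τ : ∀ l → σ l ≡ τ l
      σ≡τ = inv (Vec.map ⊖_ (drop t z)) λ l → begin
        layer l (drop t y)                                    ≡⟨ layer-drop-y l ⟩
        drop t (ys l)                                         ≡⟨ cong (drop t) (ys≡ l) ⟩
        drop t (axpy (⊖ τ l) z (layer l x′))                  ≡⟨ Vec.drop-zipWith _ z (layer l x′) ⟩
        axpy (⊖ τ l) (drop t z) (drop t (layer l x′))         ≡⟨ cong (axpy (⊖ τ l) (drop t z)) (layer-drop t l x′) ⟨
        axpy (⊖ τ l) (drop t z) (layer l (drop t x′))         ≡⟨ axpy-neg (τ l) (drop t z) (layer l (drop t x′)) ⟩
        axpy (τ l) (Vec.map ⊖_ (drop t z)) (layer l (drop t x′))  ∎

  codeword⇒∈-code : ∀ {s x} → Codeword s x → x ∈ code s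
  codeword⇒∈-code {s} {x} cw = ∈-filter⁺ (T? ∘ isCodeword s) (∈-allPoints x) (fromWitness {a? = codeword? s x} cw)

  ∈-code⇒codeword : ∀ {s x} → x ∈ code s → Codeword s x
  ∈-code⇒codeword {s} {x} x∈ =
    toWitness {a? = codeword? s x} (proj₂ (∈-filter⁻ (T? ∘ isCodeword s) {xs = allPoints (p ^ k) (t + m)} x∈))

  code-isMDS : ∀ {s} → Invariant s → isMDS (p ^ k) (t + m) (suc t) (code s) ≡ true
  code-isMDS {s} inv = allB⁺ _ (allVecs (true ∷ false ∷ []) (t + m)) planes
    where
    one : ∀ S → numTrue S ≡ t → ∀ x → (count (inPlane S x) (code s) ==ᴺ 1) ≡ true
    one S #S x = cong (_==ᴺ 1) (count-unique (inPlane S x) (Unique.filter⁺ (T? ∘ isCodeword s) (allPoints-unique (p ^ k) (t + m)))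
      (codeword⇒∈-code {s} word-codeword) (inPlane⁺ word-agrees)
      λ {y} y∈ eq → word-unique (inPlane⁻ S x y eq) (∈-code⇒codeword {s} y∈))
      where open Plane inv {S} #S x
    planes : ∀ S → (if numTrue S ==ᴺ t then allB (λ x → count (inPlane S x) (code s) ==ᴺ 1) (allPoints (p ^ k) (t + m))
      else true) ≡ true
    planes S with numTrue S ==ᴺ t in eq
    ... | false = refl
    ... | true  = allB⁺ _ (allPoints (p ^ k) (t + m)) (one S (==ᴺ⇒≡ _ _ eq))

  -- Each message `f` has a codeword, whose syndrome shows `s f`; `0 < t` provides a row to read it
  -- from.
  code-injective : 0 < t → ∀ {s s′} → Invariant s → code s ≡ code s′ → ∀ f l → s f l ≡ s′ f l
  code-injective 0<t {s} {s′} inv eq f l = begin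
    s f l                        ≡⟨ cong (λ e → s e l) drop-word ⟨
    s (drop t word) l            ≡⟨ word-codeword l 0<t ⟨
    dot (H 0) (layer l word)     ≡⟨ ∈-code⇒codeword {s′} (subst (word ∈_) eq (codeword⇒∈-code {s} word-codeword)) l 0<t ⟩
    s′ (drop t word) l           ≡⟨ cong (λ e → s′ e l) drop-word ⟩
    s′ f l                       ∎
    where
    open ≡-Reasoning
    x : Point (p ^ k) (t + m)
    x = assemble (λ l → replicate t 0# ++ᵛ layer l f)
    -- With the first `t` coordinates free, the plane fixes the message, so its codeword has message
    -- `f`.
    open Plane inv {replicate t true ++ᵛ replicate m false} (numTrue-prefix t m) x
    drop-word : drop t word ≡ f
    drop-word = trans (sym (Agree-drop⁻ t word-agrees)) (layer-ext λ l → begin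
      layer l (drop t x)                    ≡⟨ layer-drop t l x ⟩
      drop t (layer l x)                    ≡⟨ cong (drop t) (layer-assemble (λ l → replicate t 0# ++ᵛ layer l f) l) ⟩
      drop t (replicate t 0# ++ᵛ layer l f)  ≡⟨ drop-++ t (replicate t 0#) ⟩
      layer l f                             ∎)

-- Families of disjoint cubes.

lookup-ext : ∀ {A : Set} {n} {u v : Vec A n} → (∀ i → lookup u i ≡ lookup v i) → u ≡ v
lookup-ext {u = u} {v} eq =
  trans (sym (Vec.tabulate∘lookup u)) (trans (Vec.tabulate-cong eq) (Vec.tabulate∘lookup v))

module Cubes {p : ℕ} {_⊕_ _⊗_ : Op₂ (Fin p)} {⊖_ : Op₁ (Fin p)} {0# 1# : Fin p}
  (isCR : IsCommutativeRing _≡_ _⊕_ _⊗_ ⊖_ 0# 1#) (0#≢1# : 0# ≢ 1#) (k t m : ℕ)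
  {H : ℕ → Vec (Fin p) (t + m)} (0<t : 0 < t) (solvable : Linear.Solvable isCR t H) where

  open Layers p (suc k)
  open Linear isCR
  open Twisted isCR (suc k) t m solvable

  Message : Set
  Message = Point (p ^ suc k) m

  -- The cube with the rows (w , g) consists of the messages whose layer l + 1 is g_l + w_l · (layer 0):
  -- its direction is (1 , w), and every such line is written in this way exactly once.
  Cube : Set
  Cube = Vec (Vec (Fin p) (suc m)) k

  slope : Cube → Fin k → Fin p
  slope c l = head (lookup c l)

  offset : Cube → Fin k → Vec (Fin p) m
  offset c l = tail (lookup c l)

  direction : Cube → Fin (suc k) → Fin p
  direction c zero    = 1#
  direction c (suc l) = slope c l

  _∈ᶜ_ : Message → Cube → Set
  f ∈ᶜ c = ∀ l → layer (suc l) f ≡ axpy (slope c l) (layer zero f) (offset c l)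

  _∈ᶜ?_ : ∀ f c → Dec (f ∈ᶜ c)
  f ∈ᶜ? c = all? λ l → Vec.≡-dec _≟_ (layer (suc l) f) (axpy (slope c l) (layer zero f) (offset c l))

  _≟ᶜ_ : DecidableEquality Cube
  _≟ᶜ_ = Vec.≡-dec (Vec.≡-dec _≟_)

  cubes : List Cube
  cubes = allVecs (allVecs (allFin p) (suc m)) k

  cubes-unique : Unique cubes
  cubes-unique = allVecs-unique (allVecs-unique (Unique.allFin⁺ p) (suc m)) k

  length-cubes : length cubes ≡ (p ^ suc m) ^ k
  length-cubes = trans (length-allVecs (allVecs (allFin p) (suc m)) k)
    (cong (_^ k) (trans (length-allVecs (allFin p) (suc m)) (cong (_^ suc m) (length-tabulate {n = p} (λ i → i)))))

  -- The cube of slopes w which meets c in the message of c with layer 0 equal to a.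
  crossing : Cube → Vec (Fin p) m → Vec (Fin p) k → Cube
  crossing c a = zipWith (λ v w → w ∷ axpy (⊖ w) a (axpy (head v) a (tail v))) c

  -- One entry for each message of `c`, given by its layer 0, and each vector of slopes. Repetitions
  -- do no harm, since the length serves only as an upper bound.
  excluded : Cube → List Cube
  excluded c = cartesianProductWith (crossing c) (allVecs (allFin p) m) (allVecs (allFin p) k)

  length-excluded : ∀ c → length (excluded c) ≡ p ^ m * p ^ k
  length-excluded c = trans (length-cartesianProductWith (crossing c) (allVecs (allFin p) m) _)
    (cong₂ _*_ (len m) (len k))
    where
    len : ∀ n → length (allVecs (allFin p) n) ≡ p ^ n
    len n = trans (length-allVecs (allFin p) n) (cong (_^ n) (length-tabulate {n = p} (λ i → i)))

  open Greedy _≟ᶜ_ excluded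

  -- At a common message f, the equation f_(l+1) = g_l + w_l f_0 recovers the offsets of `c′` from
  -- its slopes.
  meet⇒excluded : ∀ {f c c′} → f ∈ᶜ c → f ∈ᶜ c′ → c′ ∈ excluded c
  meet⇒excluded {f} {c} {c′} f∈c f∈c′ = subst (_∈ excluded c) (sym c′≡)
    (∈-cartesianProductWith⁺ (crossing c) (∈-allVecs ∈-allFin (layer zero f)) (∈-allVecs ∈-allFin (Vec.map head c′)))
    where
    open ≡-Reasoning
    split : ∀ {n} (v : Vec (Fin p) (suc n)) → v ≡ head v ∷ tail v
    split (_ ∷ _) = refl
    a = layer zero f
    c′≡ : c′ ≡ crossing c a (Vec.map head c′)
    c′≡ = lookup-ext λ l → begin
      lookup c′ l                  ≡⟨ split (lookup c′ l) ⟩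
      slope c′ l ∷ offset c′ l     ≡⟨ cong (slope c′ l ∷_) (axpy-cancel′ (slope c′ l) a (offset c′ l)) ⟨
      slope c′ l ∷ axpy (⊖ slope c′ l) a (axpy (slope c′ l) a (offset c′ l))
                                   ≡⟨ cong (λ e → slope c′ l ∷ axpy (⊖ slope c′ l) a e) (trans (sym (f∈c′ l)) (f∈c l)) ⟩
      slope c′ l ∷ axpy (⊖ slope c′ l) a (axpy (slope c l) a (offset c l))
                                   ≡⟨ cong (λ w → w ∷ axpy (⊖ w) a (axpy (slope c l) a (offset c l))) (Vec.lookup-map l head c′) ⟨
      _                            ≡⟨ Vec.lookup-zipWith _ l c (Vec.map head c′) ⟨
      lookup (crossing c a (Vec.map head c′)) l ∎

  Disjoint : Cube → Cube → Set
  Disjoint c c′ = ∀ f → f ∈ᶜ c → ¬ f ∈ᶜ c′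

  -- The first cube containing `f` decides; for disjoint cubes the order is immaterial. The value
  -- `0#` elsewhere leaves a message in place under the moves of `Invariant`.
  shift : List Cube → Shift
  shift []      f l = 0#
  shift (c ∷ L) f l with f ∈ᶜ? c
  ... | yes _ = direction c l
  ... | no  _ = shift L f l

  -- The alternative is settled before `l` is given, so that it holds for all digits of s(f) at
  -- once.
  shift-cases : ∀ L f → (∃ λ c → c ∈ L × f ∈ᶜ c × (∀ l → shift L f l ≡ direction c l)) ⊎ (∀ l → shift L f l ≡ 0#)
  shift-cases [] f = inj₂ λ _ → refl
  shift-cases (c ∷ L) f with f ∈ᶜ? c
  ... | yes f∈c = inj₁ (c , here refl , f∈c , λ _ → refl)
  ... | no  _ with shift-cases L f
  ...   | inj₂ s≡0 = inj₂ s≡0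
  ...   | inj₁ (c′ , c′∈L , f∈c′ , s≡) = inj₁ (c′ , there c′∈L , f∈c′ , s≡)

  shift-hit : ∀ {L} → AllPairs Disjoint L → ∀ {c f} → c ∈ L → f ∈ᶜ c → ∀ l → shift L f l ≡ direction c l
  shift-hit {c′ ∷ L} (c′#L ∷ #L) {c} {f} c∈ f∈c l with f ∈ᶜ? c′ | c∈
  ... | yes _    | here refl = refl
  ... | yes f∈c′ | there c∈L = contradiction f∈c (All.lookup c′#L c∈L f f∈c′)
  ... | no  f∉c′ | here refl = contradiction f∈c f∉c′
  ... | no  _    | there c∈L = shift-hit #L c∈L f∈c l

  ∈ᶜ-translate : ∀ {c f f′} a → f ∈ᶜ c → (∀ l → layer l f′ ≡ axpy (direction c l) a (layer l f)) → f′ ∈ᶜ c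
  ∈ᶜ-translate {c} {f} {f′} a f∈c f′≡ l = begin
    layer (suc l) f′                                       ≡⟨ f′≡ (suc l) ⟩
    axpy (slope c l) a (layer (suc l) f)                   ≡⟨ cong (axpy (slope c l) a) (f∈c l) ⟩
    axpy (slope c l) a (axpy (slope c l) (layer zero f) (offset c l)) ≡⟨ axpy-axpy (slope c l) a (layer zero f) (offset c l) ⟩
    axpy (slope c l) (axpy 1# a (layer zero f)) (offset c l) ≡⟨ cong (λ e → axpy (slope c l) e (offset c l)) (f′≡ zero) ⟨
    axpy (slope c l) (layer zero f′) (offset c l)          ∎ where open ≡-Reasoning

  -- A move along the direction of a cube keeps a message in the cube, where the shift is constant;
  -- off the cubes the move is by 0.
  shift-invariant : ∀ {L} → AllPairs Disjoint L → Invariant (shift L)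
  shift-invariant {L} #L a {f} {f′} f′≡ with shift-cases L f
  ... | inj₁ (c , c∈L , f∈c , s≡) = λ l → trans
    (shift-hit #L c∈L (∈ᶜ-translate {c} {f} a f∈c (λ l → trans (f′≡ l) (cong (λ e → axpy e a (layer l f)) (s≡ l)))) l) (sym (s≡ l))
  ... | inj₂ s≡0 with refl ← layer-ext {x = f′} {f} (λ l →
    trans (f′≡ l) (trans (cong (λ e → axpy e a (layer l f)) (s≡0 l)) (axpy-0 a (layer l f)))) = λ _ → refl

  baseLayer : Cube → Fin (suc k) → Vec (Fin p) m
  baseLayer c zero    = replicate m 0#
  baseLayer c (suc l) = offset c l

  -- A point of the cube at which shifts can be compared.
  base : Cube → Message
  base c = assemble (baseLayer c)

  base-∈ᶜ : ∀ c → base c ∈ᶜ c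
  base-∈ᶜ c l = begin
    layer (suc l) (base c)                            ≡⟨ layer-assemble (baseLayer c) (suc l) ⟩
    offset c l                                        ≡⟨ axpy-zeroʳ (slope c l) (offset c l) ⟨
    axpy (slope c l) (replicate m 0#) (offset c l)    ≡⟨ cong (λ e → axpy (slope c l) e (offset c l)) (layer-assemble (baseLayer c) zero) ⟨
    axpy (slope c l) (layer zero (base c)) (offset c l) ∎
    where open ≡-Reasoning

  -- Going back from `f` along the common slopes recovers the offsets.
  same-cube : ∀ {c c′ f} → f ∈ᶜ c → f ∈ᶜ c′ → (∀ l → direction c l ≡ direction c′ l) → c ≡ c′
  same-cube {c} {c′} {f} f∈c f∈c′ d≡ = lookup-ext λ l → go (lookup c l) (lookup c′ l) (d≡ (suc l)) (trans (sym (f∈c l)) (f∈c′ l))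
    where
    go : (u v : Vec (Fin p) (suc m)) → head u ≡ head v →
      axpy (head u) (layer zero f) (tail u) ≡ axpy (head v) (layer zero f) (tail v) → u ≡ v
    go (w ∷ g) (w ∷ g′) refl eq = cong (w ∷_) (begin
      g                                   ≡⟨ axpy-cancel′ w (layer zero f) g ⟨
      axpy (⊖ w) (layer zero f) (axpy w (layer zero f) g) ≡⟨ cong (axpy (⊖ w) (layer zero f)) eq ⟩
      axpy (⊖ w) (layer zero f) (axpy w (layer zero f) g′) ≡⟨ axpy-cancel′ w (layer zero f) g′ ⟩
      g′                                  ∎) where open ≡-Reasoning

  -- At the base point of `c` the shift is the direction of `c`. Its first digit is `1#`, so some
  -- cube of `L′` contains this point; that cube has the same direction and is therefore `c`.
  shift-determines : ∀ {L L′} → AllPairs Disjoint L → (∀ f l → shift L f l ≡ shift L′ f l) → ∀ {c} → c ∈ L → c ∈ L′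
  shift-determines {L} {L′} #L eq {c} c∈L with shift-cases L′ (base c)
  ... | inj₂ s≡0 = contradiction
    (trans (sym (s≡0 zero)) (trans (sym (eq (base c) zero)) (shift-hit #L c∈L (base-∈ᶜ c) zero))) 0#≢1#
  ... | inj₁ (c′ , c′∈L′ , b∈c′ , s≡) = subst (_∈ L′)
    (sym (same-cube {f = base c} (base-∈ᶜ c) b∈c′ λ l → trans (sym (shift-hit #L c∈L (base-∈ᶜ c) l)) (trans (eq (base c) l) (s≡ l)))) c′∈L′

  selections-disjoint : ∀ n {L} → L ∈ selections cubes n → AllPairs Disjoint L
  selections-disjoint n L∈ =
    AllPairs.map (λ compat f f∈c f∈c′ → compat (meet⇒excluded {f} f∈c f∈c′)) (selections-compatible cubes n L∈)

  -- A selection is recovered from its code: the code gives the shift, the shift the set of cubes,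
  -- and the set the list.
  N-lower-bound : ∀ r n → n * (p ^ m * p ^ k + r) ≤ (p ^ suc m) ^ k → r ^ n ≤ N (p ^ suc k) (t + m) (suc t)
  N-lower-bound r n h = ℕ.≤-trans
    (length-selections (p ^ m * p ^ k) (λ c → ℕ.≤-reflexive (length-excluded c)) r n cubes-unique
      (subst (n * (p ^ m * p ^ k + r) ≤_) (sym length-cubes) h))
    (injection⇒length≤count (code ∘ shift) (isMDS (p ^ suc k) (t + m) (suc t)) (selections-unique cubes-unique n)
      (λ {L} _ → filter∈sublists (isCodeword (shift L)) (allPoints (p ^ suc k) (t + m)))
      (λ L∈ → code-isMDS (shift-invariant (selections-disjoint n L∈)))
      λ {L} {L′} L∈ L′∈ eq → selections-ext cubes-unique n L∈ L′∈
        (shift-determines (selections-disjoint n L∈) (same {L} {L′} L∈ eq))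
        (shift-determines (selections-disjoint n L′∈) (same {L′} {L} L′∈ (sym eq))))
    where
    same : ∀ {L L′} → L ∈ selections cubes n → code (shift L) ≡ code (shift L′) → ∀ f l → shift L f l ≡ shift L′ f l
    same {L} {L′} L∈ = code-injective 0<t {shift L} {shift L′} (shift-invariant (selections-disjoint n L∈))

-- Codes over the prime field and the final estimate.

module PrimeField {p : ℕ} (p-prime : Prime p) where
  private instance
    p≢0 : NonZero p
    p≢0 = prime⇒nonZero p-prime

  open Residues p using (isCommutativeRing; toℕ-mod)
  open Linear isCommutativeRing using (Solvable)
  open Linear.GeneralisedVandermonde isCommutativeRing (residue-inverse p-prime)

  p≥2 : 2 ≤ p
  p≥2 = ℕ.nonTrivial⇒n>1 p {{prime⇒nonTrivial p-prime}}

  0≢1 : 0 mod p ≢ 1 mod p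
  0≢1 eq with () ← trans (sym (m<n⇒m%n≡m (ℕ.<⇒≤ p≥2))) (trans (sym (toℕ-mod 0)) (trans (cong toℕ eq) (trans (toℕ-mod 1) (m<n⇒m%n≡m p≥2))))

  -- The single check is the sum of all coordinates: weights 1, and the node 0 repeated.
  parityCheck : ∀ d → ∃ λ (H : ℕ → Vec (Fin p) d) → Solvable 1 H
  parityCheck d = _ , vandermonde-solvable 1 columns (weights d)
    where
    columns : Vec Column d
    columns = replicate d (1 mod p , 0 mod p)
    weights : ∀ n → NonZeroWeights (replicate n (1 mod p , 0 mod p))
    weights zero    = []
    weights (suc n) = 0≢1 ∘ sym ∷ weights n

  -- The nodes are distinct field elements, at most `p` in number; the node at infinity adds one
  -- more column.
  reedSolomon : ∀ t {n} → n ≤ p → ∃ λ (H : ℕ → Vec (Fin p) (suc n)) → Solvable (suc t) H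
  reedSolomon t {n} n≤p = _ , extend-solvable t (λ j → row j columns)
    (vandermonde-solvable t columns (general t)) (vandermonde-solvable (suc t) columns (general (suc t)))
    where
    columns : Vec Column n
    columns = tabulate (λ i → 1 mod p , inject≤ i n≤p)
    weights : NonZeroWeights columns
    weights = VecAll.tabulate⁺ (λ _ → 0≢1 ∘ sym)
    nodes : DistinctNodes columns
    nodes = VecAllPairs.tabulate⁺ (λ i≢j eq → i≢j (inject≤-injective n≤p n≤p _ _ eq))
    general : ∀ t → GeneralPosition t columns
    general zero          = tt
    general (suc zero)    = weights
    general (suc (suc t)) = weights , nodes

  -- The count yields the factor k + m - 1 in place of k + m. This is at least b / (b + 1) times k +
  -- m as soon as b ≤ k + m - 1; the power `suc b` avoids the fraction.
  N-bound : ∀ {t m} → 0 < t → 0 < m → (∃ λ (H : ℕ → Vec (Fin p) (t + m)) → Solvable t H) →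
    ∀ b k → 3 + b ≤ k → p ^ (b * ((k + m) * p ^ ((k ∸ 2) * m ∸ 1))) ≤ N (p ^ k) (t + m) (suc t) ^ suc b
  N-bound {t} {m} 0<t 0<m (H , solvable) b (suc (suc k)) (s≤s (s≤s b<k)) = begin
    p ^ (b * ((suc (suc k) + m) * T))           ≤⟨ ℕ.^-monoʳ-≤ p exponents ⟩
    p ^ ((suc k + m) * T * suc b)               ≡⟨ ℕ.^-*-assoc p ((suc k + m) * T) (suc b) ⟨
    (p ^ ((suc k + m) * T)) ^ suc b             ≡⟨ cong (_^ suc b) (ℕ.^-*-assoc p (suc k + m) T) ⟨
    (r ^ T) ^ suc b                             ≤⟨ ℕ.^-monoˡ-≤ (suc b) (N-lower-bound r T room) ⟩
    N (p ^ suc (suc k)) (t + m) (suc t) ^ suc b ∎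
    where
    open ℕ.≤-Reasoning
    -- From here `k` is two less than in the statement, and `suc k` counts the layers beyond layer
    -- 0.
    open Cubes isCommutativeRing 0≢1 (suc k) t m 0<t solvable using (N-lower-bound)
    e = k * m ∸ 1
    T = p ^ e
    r = p ^ (suc k + m)
    -- The threshold `3 + b` makes `k` positive, so the truncated subtraction in `e` is exact.
    1+e : suc e ≡ k * m
    1+e = ℕ.m+[n∸m]≡n (ℕ.*-mono-≤ (ℕ.≤-trans (s≤s z≤n) b<k) 0<m)
    -- A pick excludes at most `r` cubes, so its budget is `r + r`, at most `p * r` because p is at
    -- least 2; and `T * (p * r)` is exactly the number of cubes.
    room : T * (p ^ m * p ^ suc k + r) ≤ (p ^ suc m) ^ suc k
    room = begin
      T * (p ^ m * p ^ suc k + r)     ≡⟨ cong (λ x → T * (x + r)) (trans (sym (ℕ.^-distribˡ-+-* p m (suc k))) (cong (p ^_) (ℕ.+-comm m (suc k)))) ⟩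
      T * (r + r)                     ≡⟨ cong (λ x → T * (r + x)) (ℕ.+-identityʳ r) ⟨
      T * (2 * r)                     ≤⟨ ℕ.*-monoʳ-≤ T (ℕ.*-monoˡ-≤ r p≥2) ⟩
      T * (p * r)                     ≡⟨ ℕ.^-distribˡ-+-* p e (suc (suc k + m)) ⟨
      p ^ (e + suc (suc k + m))       ≡⟨ cong (p ^_) (ℕ.+-suc e (suc k + m)) ⟩
      p ^ (suc e + (suc k + m))       ≡⟨ cong (λ x → p ^ (x + (suc k + m))) 1+e ⟩
      p ^ (k * m + (suc k + m))       ≡⟨ cong (p ^_) (arith k m) ⟩
      p ^ (suc m * suc k)             ≡⟨ ℕ.^-*-assoc p (suc m) (suc k) ⟨
      (p ^ suc m) ^ suc k             ∎
      where
      arith : ∀ k m → k * m + (suc k + m) ≡ suc m * suc k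
      arith = solve-∀
    exponents : b * ((suc (suc k) + m) * T) ≤ (suc k + m) * T * suc b
    exponents = begin
      b * ((suc (suc k) + m) * T)         ≡⟨ expand b (suc k + m) T ⟩
      (b + (suc k + m) * b) * T           ≤⟨ ℕ.*-monoˡ-≤ T (ℕ.+-monoˡ-≤ _ b≤) ⟩
      (suc k + m + (suc k + m) * b) * T   ≡⟨ collect b (suc k + m) T ⟩
      (suc k + m) * T * suc b             ∎
      where
      b≤ : b ≤ suc k + m
      b≤ = ℕ.≤-trans (ℕ.<⇒≤ b<k) (ℕ.≤-trans (ℕ.n≤1+n k) (ℕ.m≤m+n (suc k) m))
      expand : ∀ b n T → b * (suc n * T) ≡ (b + n * b) * T
      expand = solve-∀
      collect : ∀ b n T → (n + n * b) * T ≡ n * T * suc b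
      collect = solve-∀

-- The factor 1 + o(1) is rendered by (b - 1) / b for arbitrary `b`: after taking logarithms and
-- dividing by `b`, the lower bound for ln N carries the factor 1 - 1/b once `k` is at least `K`.
theorem1 : (p d ρ : ℕ) → Prime p →
    ((3 ≤ ρ × ρ ≤ p × ρ ≤ d × d ≤ suc p) ⊎ (ρ ≡ 2 × 2 ≤ d)) →
    (b : ℕ) → 1 ≤ b →
    ∃ λ K → (k : ℕ) → K ≤ k →
    p ^ ((b ∸ 1) * ((k + (d ∸ ρ + 1)) * p ^ ((k ∸ 2) * (d ∸ ρ + 1) ∸ 1)))
    ≤ N (p ^ k) d ρ ^ b
theorem1 p d ρ p-prime range (suc b) _ = 3 + b , λ k → bound range k
  where
  open PrimeField p-prime
  0<m : ∀ n → 0 < n + 1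
  0<m n = subst (0 <_) (ℕ.+-comm 1 n) z<s
  length≡ : ∀ {t} → suc t ≤ d → t + (d ∸ suc t + 1) ≡ d
  length≡ {t} t<d = trans (cong (t +_) (ℕ.+-comm (d ∸ suc t) 1)) (trans (ℕ.+-suc t (d ∸ suc t)) (ℕ.m+[n∸m]≡n t<d))
  bound : ((3 ≤ ρ × ρ ≤ p × ρ ≤ d × d ≤ suc p) ⊎ (ρ ≡ 2 × 2 ≤ d)) → ∀ k → 3 + b ≤ k →
    p ^ (b * ((k + (d ∸ ρ + 1)) * p ^ ((k ∸ 2) * (d ∸ ρ + 1) ∸ 1))) ≤ N (p ^ k) d ρ ^ suc b
  -- Here ρ = t + 2, so there are `suc t` checks; the length `suc (t + m)` is d, at most p + 1,
  -- which leaves at most `p` finite nodes.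
  bound (inj₁ (s≤s {n = suc t} _ , _ , ρ≤d , d≤1+p)) k K≤k =
    subst (λ e → p ^ (b * ((k + m) * p ^ ((k ∸ 2) * m ∸ 1))) ≤ N (p ^ k) e ρ ^ suc b) (length≡ ρ≤d)
      (N-bound {suc t} {m} z<s (0<m (d ∸ ρ)) (reedSolomon t (ℕ.≤-pred (subst (_≤ suc p) (sym (length≡ ρ≤d)) d≤1+p))) b k K≤k)
    where m = d ∸ ρ + 1
  bound (inj₂ (refl , 2≤d)) k K≤k =
    subst (λ e → p ^ (b * ((k + m) * p ^ ((k ∸ 2) * m ∸ 1))) ≤ N (p ^ k) e 2 ^ suc b) (length≡ 2≤d)
      (N-bound {1} {m} z<s (0<m (d ∸ 2)) (parityCheck (1 + m)) b k K≤k)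
    where m = d ∸ ρ + 1
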